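{- Let $(M, M')$ be a matroid perspective on a finite ground set $E$ with a total ordering $<$ on $E$. Then the trivariate Tutte polynomial of $(M,M')$ can be expressed as $$T_{M,M'}(x,y,z) = \sum_{X\in \mathcal{D}(M, M', <)} x^{r(M'/X)}\,y^{r^*(M|X)}\,z^{r(M) - r(M') - (r_M(X) - r_{M'}(X))}.$$
   Context: Matroids are on a finite ground set $E$; $r(N)$ is the rank of a matroid $N$, $r_N(X)$ the rank in $N$ of a subset $X$, and $N^*$ the dual of $N$. $M|X$ is the restriction of $M$ to $X$ (ground set $X$), $M'/X$ is the contraction of $M'$ by $X$ (ground set $E\setminus X$), and $r^*(M|X)$ denotes the rank of the dual matroid $(M|X)^*$. An $N$-circuit is a circuit of $N$. $X\cup e$ means $X\cup\{e\}$. Matroid perspective: a pair $(M,M')$ of matroids on a common ground set $E$ is a matroid perspective if every circuit of $M$ is a union of circuits of $M'$. Activities: for a matroid $N$ on $E$ with total ordering $<$ on $E$, and $X\subseteq E$, $$\mathrm{Int}_N(X) := \{e\in X : (E\setminus X)\cup e \text{ contains an } N^*\text{ -circuit with } e \text{ as its minimal element}\},$$ $$\mathrm{Ext}_N(X) := \{e\in E\setminus X : X\cup e \text{ contains an } N\text{ -circuit with } e \text{ as its minimal element}\}.$$ Trivariate Tutte polynomial (Las Vergnas), in its internal-external activities description: for a matroid perspective $(M,M')$ on $E$ with total ordering $<$, $$T_{M, M'}(x,y,z) = \sum_{B} x^{|\mathrm{Int}_{M'}(B)|}\,y^{|\mathrm{Ext}_M(B)|}\,z^{r(M) - r(M') -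 (r_M(B) - r_{M'}(B))},$$ where the sum is over all $B\subseteq E$ that are independent in $M$ and spanning in $M'$. Compatibility: a set $X\subseteq E$ is $(N,<)$-compatible if there is no $N$-circuit $C$ with $X\cap C=\{\min(C)\}$. The set $\mathcal{D}(M,M',<)$ is $$\mathcal{D}(M, M', <) := \{X\subseteq E : X \text{ is } ((M')^*,<)\text{ -compatible and } E\setminus X \text{ is } (M,<)\text{ -compatible}\}.$$ -}

module Defs where

open import Algebra.Bundles using (CommutativeRing)
import Algebra.Properties.Semiring.Exp as Exp
open import Data.Bool.Base using (true; false)
open import Data.Empty using (⊥-elim)
open import Data.Fin.Base using (Fin)
open import Data.Fin.Properties using (any?; all?)
open import Data.Fin.Subset
open import Data.Fin.Subset.Properties
open import Data.List.Base as List using (List; foldr; filter)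
open import Data.List.Extrema.Nat using (max)
open import Data.List.Relation.Unary.All using (All)
open import Data.Nat.Base as ℕ using (ℕ; zero; suc; _∸_; _≤_; z≤n; s≤s)
import Data.Nat.Properties as ℕ
open import Data.Product.Base using (∃; _×_; _,_; proj₁; proj₂)
open import Data.Sum.Base using ([_,_]′)
open import Data.Vec.Base as Vec using ([]; _∷_; here; there)
open import Function.Base using (_∘_; id)
open import Level using (Level; 0ℓ)
open import Relation.Binary.Core using (Rel)
open import Relation.Binary.PropositionalEquality
open import Relation.Binary.Structures using (IsStrictTotalOrder)
open import Relation.Nullary
open import Relation.Nullary.Decidable using (_×-dec_; _→-dec_; ¬?; map′; decidable-stable)
open import Relation.Unary using (Pred; Decidable)

import Data.Vec.Properties as Vec
import Data.Bool.Properties as Bool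

private
  variable
    n : ℕ
    p ℓ : Level

subsets : ∀ n → List (Subset n)
subsets zero    = List.[ [] ]
subsets (suc n) = List.map (outside ∷_) (subsets n) List.++ List.map (inside ∷_) (subsets n)

separate : {P : Pred (Fin n) p} → Decidable P → Subset n
separate P? = Vec.tabulate (does ∘ P?)

allSubset? : {P : Pred (Subset n) p} → Decidable P → Dec (∀ S → P S)
allSubset? P? = map′
  (λ ¬∃¬P S → decidable-stable (P? S) (λ ¬PS → ¬∃¬P (S , ¬PS)))
  (λ ∀P (S , ¬PS) → ¬PS (∀P S))
  (¬? (anySubset? (¬? ∘ P?)))

x∈p─q⇒x∉q : ∀ {x} (S T : Subset n) → x ∈ S ─ T → x ∉ T
x∈p─q⇒x∉q (_ ∷ S) (_ ∷ T)     (there x∈) (there x∈T) = x∈p─q⇒x∉q S T x∈ x∈T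
x∈p─q⇒x∉q (_ ∷ S) (true ∷ T)  ()         here

∣p∪q∣≤∣p∣+∣q∣ : (S T : Subset n) → ∣ S ∪ T ∣ ≤ ∣ S ∣ ℕ.+ ∣ T ∣
∣p∪q∣≤∣p∣+∣q∣ []          []          = z≤n
∣p∪q∣≤∣p∣+∣q∣ (false ∷ S) (false ∷ T) = ∣p∪q∣≤∣p∣+∣q∣ S T
∣p∪q∣≤∣p∣+∣q∣ (false ∷ S) (true ∷ T)  =
  subst (suc ∣ S ∪ T ∣ ≤_) (sym (ℕ.+-suc ∣ S ∣ ∣ T ∣)) (s≤s (∣p∪q∣≤∣p∣+∣q∣ S T))
∣p∪q∣≤∣p∣+∣q∣ (true ∷ S)  (false ∷ T) = s≤s (∣p∪q∣≤∣p∣+∣q∣ S T)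
∣p∪q∣≤∣p∣+∣q∣ (true ∷ S)  (true ∷ T)  =
  s≤s (ℕ.≤-trans (∣p∪q∣≤∣p∣+∣q∣ S T) (ℕ.+-monoʳ-≤ ∣ S ∣ (ℕ.n≤1+n ∣ T ∣)))

disjoint⇒∣p∣+∣q∣≤∣p∪q∣ : (S T : Subset n) → (∀ {x} → x ∈ S → x ∉ T) →
                         ∣ S ∣ ℕ.+ ∣ T ∣ ≤ ∣ S ∪ T ∣
disjoint⇒∣p∣+∣q∣≤∣p∪q∣ []          []          _ = z≤n
disjoint⇒∣p∣+∣q∣≤∣p∪q∣ (true ∷ S)  (true ∷ T)  d with () ← d here here
disjoint⇒∣p∣+∣q∣≤∣p∪q∣ (true ∷ S)  (false ∷ T) d =
  s≤s (disjoint⇒∣p∣+∣q∣≤∣p∪q∣ S T λ x∈S x∈T → d (there x∈S) (there x∈T))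
disjoint⇒∣p∣+∣q∣≤∣p∪q∣ (false ∷ S) (true ∷ T)  d =
  subst (_≤ suc ∣ S ∪ T ∣) (sym (ℕ.+-suc ∣ S ∣ ∣ T ∣))
    (s≤s (disjoint⇒∣p∣+∣q∣≤∣p∪q∣ S T λ x∈S x∈T → d (there x∈S) (there x∈T)))
disjoint⇒∣p∣+∣q∣≤∣p∪q∣ (false ∷ S) (false ∷ T) d =
  disjoint⇒∣p∣+∣q∣≤∣p∪q∣ S T λ x∈S x∈T → d (there x∈S) (there x∈T)

∪-lub : {S T U : Subset n} → S ⊆ U → T ⊆ U → S ∪ T ⊆ U
∪-lub S⊆U T⊆U = [ S⊆U , T⊆U ]′ ∘ x∈p∪q⁻ _ _

⁅⁆⊆ : ∀ {x} {S : Subset n} → x ∈ S → ⁅ x ⁆ ⊆ S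
⁅⁆⊆ {x = x} {S} x∈S y∈ = subst (_∈ S) (sym (x∈⁅y⁆⇒x≡y x y∈)) x∈S

∉⇒∣p∣<∣p∪⁅x⁆∣ : ∀ {x} (S : Subset n) → x ∉ S → ∣ S ∣ ℕ.< ∣ S ∪ ⁅ x ⁆ ∣
∉⇒∣p∣<∣p∪⁅x⁆∣ {x = x} S x∉S =
  p⊂q⇒∣p∣<∣q∣ (p⊆p∪q ⁅ x ⁆ , x , q⊆p∪q S ⁅ x ⁆ (x∈⁅x⁆ x) , x∉S)

-- The ground set is a subset of Fin n, so that restrictions and contractions
-- of matroids on E are matroids on subsets of E.  Independence is decidable,
-- as it has to be for ranks to be computed and for sums over sets of subsets
-- to be formed.
record Matroid {n : ℕ} (E : Subset n) : Set₁ where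
  field
    Indep   : Pred (Subset n) 0ℓ
    indep?  : Decidable Indep
    ⊆ground : ∀ {I} → Indep I → I ⊆ E
    ∅-indep : Indep ⊥
    hereditary   : ∀ {I J} → J ⊆ I → Indep I → Indep J
    augmentation : ∀ {I J} → Indep I → Indep J → ∣ I ∣ ℕ.< ∣ J ∣ →
                   ∃ λ e → e ∈ J × e ∉ I × Indep (I ∪ ⁅ e ⁆)

  Basis : Pred (Subset n) 0ℓ
  Basis B = Indep B × (∀ J → Indep J → B ⊆ J → J ⊆ B)

  Circuit : Pred (Subset n) 0ℓ
  Circuit C = C ⊆ E × ¬ Indep C × (∀ J → J ⊂ C → Indep J)

  basis? : Decidable Basis
  basis? B = indep? B ×-dec
    allSubset? λ J → indep? J →-dec (B ⊆? J →-dec J ⊆? B)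

  circuit? : Decidable Circuit
  circuit? C = C ⊆? E ×-dec ¬? (indep? C) ×-dec
    allSubset? λ J → J ⊂? C →-dec indep? J

  rank : Subset n → ℕ
  rank X = max 0 (List.map ∣_∣ (filter (λ I → indep? I ×-dec I ⊆? X) (subsets n)))

  Spanning : Pred (Subset n) 0ℓ
  Spanning X = X ⊆ E × rank X ≡ rank E

  spanning? : Decidable Spanning
  spanning? X = X ⊆? E ×-dec rank X ℕ.≟ rank E

open Matroid public using (Indep; Basis; Circuit; Spanning; rank)

r : {E : Subset n} → Matroid E → ℕ
r {E = E} N = rank N E

module MatroidProperties {E : Subset n} (N : Matroid E) where
  open Matroid N hiding (Indep; Basis; Circuit; Spanning; rank)

  indep≤basis : ∀ {I B} → Indep N I → Basis N B → ∣ I ∣ ≤ ∣ B ∣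
  indep≤basis {I} {B} iI (iB , maxB) with ∣ I ∣ ℕ.≤? ∣ B ∣
  ... | yes I≤B = I≤B
  ... | no  I≰B with e , _ , e∉B , iB∪e ← augmentation iB iI (ℕ.≰⇒> I≰B) =
    contradiction (maxB _ iB∪e (p⊆p∪q ⁅ e ⁆) (q⊆p∪q B ⁅ e ⁆ (x∈⁅x⁆ e))) e∉B

  large⇒basis : ∀ {I B} → Indep N I → Basis N B → ∣ B ∣ ≤ ∣ I ∣ → Basis N I
  large⇒basis {I} {B} iI bB B≤I = iI , maxI
    where
    maxI : ∀ J → Indep N J → I ⊆ J → J ⊆ I
    maxI J iJ I⊆J {x} x∈J with x ∈? I
    ... | yes x∈I = x∈I
    ... | no  x∉I = contradiction
      (ℕ.<-≤-trans (p⊂q⇒∣p∣<∣q∣ (I⊆J , x , x∈J , x∉I)) (ℕ.≤-trans (indep≤basis iJ bB) B≤I))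
      (ℕ.<-irrefl refl)

  extendWithin : ∀ {I J} → Indep N I → Indep N J →
                 ∃ λ K → Indep N K × I ⊆ K × K ⊆ I ∪ J × ∣ J ∣ ≤ ∣ K ∣
  extendWithin {J = J} iI iJ = go _ iI ℕ.≤-refl
    where
    go : ∀ k {I} → Indep N I → ∣ J ∣ ∸ ∣ I ∣ ≤ k →
         ∃ λ K → Indep N K × I ⊆ K × K ⊆ I ∪ J × ∣ J ∣ ≤ ∣ K ∣
    go k {I} iI d≤k with ∣ J ∣ ℕ.≤? ∣ I ∣
    ... | yes J≤I = I , iI , id , p⊆p∪q J , J≤I
    go zero    iI d≤k | no J≰I = contradiction (ℕ.m∸n≡0⇒m≤n (ℕ.n≤0⇒n≡0 d≤k)) J≰I
    go (suc k) {I} iI d≤k | no J≰I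
      with e , e∈J , e∉I , iI∪e ← augmentation iI iJ (ℕ.≰⇒> J≰I)
      with K , iK , I∪e⊆K , K⊆ , J≤K ← go k iI∪e (ℕ.≤-pred (ℕ.<-≤-trans
             (ℕ.∸-monoʳ-< (∉⇒∣p∣<∣p∪⁅x⁆∣ I e∉I)
               (ℕ.≤-trans (∣p∪q∣≤∣p∣+∣q∣ I ⁅ e ⁆)
                 (subst (_≤ ∣ J ∣) (trans (ℕ.+-comm 1 ∣ I ∣) (cong (∣ I ∣ ℕ.+_) (sym (∣⁅x⁆∣≡1 e)))) (ℕ.≰⇒> J≰I))))
             d≤k)) =
      K , iK , I∪e⊆K ∘ p⊆p∪q ⁅ e ⁆
        , ∪-lub (∪-lub (p⊆p∪q J) (⁅⁆⊆ (q⊆p∪q I J e∈J))) (q⊆p∪q I J) ∘ K⊆ , J≤K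

  ∃basis : ∃ (Basis N)
  ∃basis = go n ∅-indep (ℕ.m∸n≤m n ∣ ⊥ {n} ∣)
    where
    go : ∀ k {I} → Indep N I → n ∸ ∣ I ∣ ≤ k → ∃ (Basis N)
    go k {I} iI d≤k with anySubset? (λ J → indep? J ×-dec I ⊂? J)
    ... | no ∄J = I , iI , maxI
      where
      maxI : ∀ J → Indep N J → I ⊆ J → J ⊆ I
      maxI J iJ I⊆J {x} x∈J with x ∈? I
      ... | yes x∈I = x∈I
      ... | no  x∉I = ⊥-elim (∄J (J , iJ , I⊆J , x , x∈J , x∉I))
    go zero    iI d≤k | yes (J , iJ , I⊂J) = contradiction
      (ℕ.<-≤-trans (p⊂q⇒∣p∣<∣q∣ I⊂J) (ℕ.≤-trans (∣p∣≤n J) (ℕ.m∸n≡0⇒m≤n (ℕ.n≤0⇒n≡0 d≤k))))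
      (ℕ.<-irrefl refl)
    go (suc k) iI d≤k | yes (J , iJ , I⊂J) = go k iJ
      (ℕ.≤-pred (ℕ.<-≤-trans (ℕ.∸-monoʳ-< (p⊂q⇒∣p∣<∣q∣ I⊂J) (∣p∣≤n J)) d≤k))

  dualAugmentation : ∀ {I J} → (∃ λ B → Basis N B × I ⊆ E ─ B) →
    (∃ λ B → Basis N B × J ⊆ E ─ B) → ∣ I ∣ ℕ.< ∣ J ∣ →
    ∃ λ e → e ∈ J × e ∉ I × (∃ λ B → Basis N B × I ∪ ⁅ e ⁆ ⊆ E ─ B)
  dualAugmentation {I} {J} (B₁ , bB₁ , I⊆) (B₂ , bB₂ , J⊆) I<J
    with K , iK , B₂─I⊆K , K⊆ , B₁≤K ←
           extendWithin (hereditary (p─q⊆p B₂ I) (proj₁ bB₂)) (proj₁ bB₁)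
    with any? (λ e → e ∈? J ×-dec ¬? (e ∈? I) ×-dec ¬? (e ∈? K))
  ... | yes (e , e∈J , e∉I , e∉K) =
    e , e∈J , e∉I , K , large⇒basis iK bB₁ B₁≤K , ∪-lub
      (λ x∈I → x∈p∧x∉q⇒x∈p─q (p─q⊆p E B₁ (I⊆ x∈I)) λ x∈K →
        [ (λ x∈B₂─I → x∈p─q⇒x∉q B₂ I x∈B₂─I x∈I) , x∈p─q⇒x∉q E B₁ (I⊆ x∈I) ]′
          (x∈p∪q⁻ (B₂ ─ I) B₁ (K⊆ x∈K)))
      (⁅⁆⊆ (x∈p∧x∉q⇒x∈p─q (p─q⊆p E B₂ (J⊆ e∈J)) e∉K))
  ... | no ∄e = contradiction (ℕ.+-cancelʳ-≤ _ _ _ J+B₂≤I+B₂) (ℕ.<⇒≱ I<J)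
    where
    J⊆I∪K : J ⊆ I ∪ K
    J⊆I∪K {x} x∈J with x ∈? I | x ∈? K
    ... | yes x∈I | _       = p⊆p∪q K x∈I
    ... | no _    | yes x∈K = q⊆p∪q I K x∈K
    ... | no x∉I  | no x∉K  = contradiction (x , x∈J , x∉I , x∉K) ∄e

    B₂⊆I∪K : B₂ ⊆ I ∪ K
    B₂⊆I∪K {x} x∈B₂ with x ∈? I
    ... | yes x∈I = p⊆p∪q K x∈I
    ... | no  x∉I = q⊆p∪q I K (B₂─I⊆K (x∈p∧x∉q⇒x∈p─q x∈B₂ x∉I))

    open ℕ.≤-Reasoning
    J+B₂≤I+B₂ : ∣ J ∣ ℕ.+ ∣ B₂ ∣ ≤ ∣ I ∣ ℕ.+ ∣ B₂ ∣
    J+B₂≤I+B₂ = begin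
      ∣ J ∣ ℕ.+ ∣ B₂ ∣  ≤⟨ disjoint⇒∣p∣+∣q∣≤∣p∪q∣ J B₂ (x∈p─q⇒x∉q E B₂ ∘ J⊆) ⟩
      ∣ J ∪ B₂ ∣        ≤⟨ p⊆q⇒∣p∣≤∣q∣ (∪-lub J⊆I∪K B₂⊆I∪K) ⟩
      ∣ I ∪ K ∣         ≤⟨ ∣p∪q∣≤∣p∣+∣q∣ I K ⟩
      ∣ I ∣ ℕ.+ ∣ K ∣   ≤⟨ ℕ.+-monoʳ-≤ ∣ I ∣ (indep≤basis iK bB₂) ⟩
      ∣ I ∣ ℕ.+ ∣ B₂ ∣  ∎

infix 8 _⋆
infixl 7 _↾_ _/_

-- The bases of N ⋆ are the complements of the bases of N.
_⋆ : {E : Subset n} → Matroid E → Matroid E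
_⋆ {E = E} N = record
  { Indep        = λ I → ∃ λ B → Basis N B × I ⊆ E ─ B
  ; indep?       = λ I → anySubset? λ B → Matroid.basis? N B ×-dec I ⊆? E ─ B
  ; ⊆ground      = λ (B , _ , I⊆E─B) → p─q⊆p E B ∘ I⊆E─B
  ; ∅-indep      = let B , bB = ∃basis in B , bB , ⊥⊆
  ; hereditary   = λ J⊆I (B , bB , I⊆E─B) → B , bB , I⊆E─B ∘ J⊆I
  ; augmentation = dualAugmentation
  }
  where open MatroidProperties N

-- Restriction to X, meant for X ⊆ E (an element of X outside E becomes a loop).
_↾_ : {E : Subset n} → Matroid E → (X : Subset n) → Matroid X
N ↾ X = record
  { Indep        = λ I → Indep N I × I ⊆ X
  ; indep?       = λ I → indep? I ×-dec I ⊆? X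
  ; ⊆ground      = proj₂
  ; ∅-indep      = ∅-indep , ⊥⊆
  ; hereditary   = λ J⊆I (iI , I⊆X) → hereditary J⊆I iI , I⊆X ∘ J⊆I
  ; augmentation = λ (iI , I⊆X) (iJ , J⊆X) I<J →
      let e , e∈J , e∉I , iI∪e = augmentation iI iJ I<J
      in  e , e∈J , e∉I , iI∪e , ∪-lub I⊆X (⁅⁆⊆ (J⊆X e∈J))
  }
  where open Matroid N hiding (Indep)

-- Contraction, defined as usual by N/X = (N* ∖ X)*.
_/_ : {E : Subset n} → Matroid E → (X : Subset n) → Matroid (E ─ X)
_/_ {E = E} N X = (N ⋆ ↾ (E ─ X)) ⋆

Perspective : {E : Subset n} → Matroid E → Matroid E → Set
Perspective M M′ = ∀ C → Circuit M C → ∃ λ Ds → All (Circuit M′) Ds × C ≡ ⋃ Ds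

-- The order is given on all of Fin n; every total order on a ground set
-- E ⊆ Fin n is the restriction of such an order.
module _ {_<_ : Rel (Fin n) ℓ} (<-sto : IsStrictTotalOrder _≡_ _<_) where
  open IsStrictTotalOrder <-sto using (_<?_)

  IsMin : Fin n → Subset n → Set ℓ
  IsMin e C = e ∈ C × (∀ f → f ∈ C → ¬ (f < e))

  isMin? : ∀ e C → Dec (IsMin e C)
  isMin? e C = e ∈? C ×-dec all? λ f → f ∈? C →-dec ¬? (f <? e)

  module _ {E : Subset n} (N : Matroid E) where
    open Matroid N using (circuit?)

    ContainsCircuitWithMin : Subset n → Fin n → Set ℓ
    ContainsCircuitWithMin Y e = ∃ λ C → Circuit N C × C ⊆ Y × IsMin e C

    containsCircuitWithMin? : ∀ Y e → Dec (ContainsCircuitWithMin Y e)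
    containsCircuitWithMin? Y e =
      anySubset? λ C → circuit? C ×-dec C ⊆? Y ×-dec isMin? e C

    Compatible : Pred (Subset n) ℓ
    Compatible X = X ⊆ E × ¬ (∃ λ C → Circuit N C × ∃ λ e → IsMin e C × X ∩ C ≡ ⁅ e ⁆)

    compatible? : Decidable Compatible
    compatible? X = X ⊆? E ×-dec ¬? (anySubset? λ C → circuit? C ×-dec
      any? λ e → isMin? e C ×-dec Vec.≡-dec Bool._≟_ (X ∩ C) ⁅ e ⁆)

  Int : {E : Subset n} → Matroid E → Subset n → Subset n
  Int {E} N X = separate λ e →
    e ∈? X ×-dec containsCircuitWithMin? (N ⋆) ((E ─ X) ∪ ⁅ e ⁆) e

  Ext : {E : Subset n} → Matroid E → Subset n → Subset n
  Ext {E} N X = separate λ e →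
    e ∈? (E ─ X) ×-dec containsCircuitWithMin? N (X ∪ ⁅ e ⁆) e

  𝒟 : {E : Subset n} → Matroid E → Matroid E → Pred (Subset n) ℓ
  𝒟 {E} M M′ X = X ⊆ E × Compatible (M′ ⋆) X × Compatible M (E ─ X)

  𝒟? : {E : Subset n} (M M′ : Matroid E) → Decidable (𝒟 M M′)
  𝒟? {E} M M′ X = X ⊆? E ×-dec compatible? (M′ ⋆) X ×-dec compatible? M (E ─ X)

-- A polynomial with integer coefficients is represented by its values in an
-- arbitrary commutative ring R; an identity holding for all R (in particular
-- for R = ℤ[x,y,z]) is an identity of polynomials.
module Evaluation {c ℓ′} (R : CommutativeRing c ℓ′) where
  open CommutativeRing R public using (Carrier; _≈_; _+_; _*_; 0#; semiring)
  open Exp semiring public using (_^_)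

  ∑ : {P : Pred (Subset n) p} → Decidable P → (Subset n → Carrier) → Carrier
  ∑ P? f = foldr (λ X s → f X + s) 0# (filter P? (subsets _))

  -- In the exponent of z no subtraction is truncated when (M, M′) is a
  -- perspective: then r_M(Y) - r_M(X) ≥ r_M′(Y) - r_M′(X) whenever X ⊆ Y ⊆ E.
  T : {_<_ : Rel (Fin n) ℓ} → IsStrictTotalOrder _≡_ _<_ →
      {E : Subset n} → Matroid E → Matroid E → Carrier → Carrier → Carrier → Carrier
  T <-sto M M′ x y z =
    ∑ (λ B → Matroid.indep? M B ×-dec Matroid.spanning? M′ B) λ B →
      x ^ ∣ Int <-sto M′ B ∣ *
      y ^ ∣ Ext <-sto M B ∣ *
      z ^ ((r M ∸ r M′) ∸ (rank M B ∸ rank M′ B))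

{-# OPTIONS --safe #-}
module Submission where

-- Call e active for X in N if e lies in the N-closure of {f ∈ X : e < f}.  Let
-- A(X) be the set of elements that are active for X in M or for E ─ X in M′*.
-- Both kinds of activity of e are decided by the elements of X above e, they
-- exclude each other, and neither changes when an active element is moved into
-- or out of X; hence X ↦ X △ A(X) is an involution on the subsets of E.  The sets
-- that are independent in M and spanning in M′ are those which contain no
-- element active in M and all elements active in M′*; the members of 𝒟 satisfy
-- the opposite conditions, so the involution exchanges the two families.
-- Building a set up from its largest element shows that it contains as many
-- active elements as its size exceeds its rank, which gives the exponents.

open import Defs
open import Algebra.Bundles using (CommutativeRing)
open import Data.Bool.Base using (false; _xor_)
import Data.Bool.Properties as Bool
open import Data.Empty using (⊥-elim)
open import Data.Fin.Base using (Fin)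
open import Data.Fin.Induction using (spo-wellFounded)
open import Data.Fin.Properties using (any?; _≟_)
open import Data.Fin.Subset
open import Data.Fin.Subset.Induction using (⊂-wellFounded)
open import Data.Fin.Subset.Properties
open import Data.List.Base as List using (List; []; _∷_; allFin; filter; foldr)
import Data.List.Extrema.Nat as Extrema
open import Data.List.Membership.Propositional using () renaming (_∈_ to _∈ₗ_)
import Data.List.Membership.Propositional.Properties as Membership
open import Data.List.Membership.Propositional.Properties.WithK using (unique∧set⇒bag)
open import Data.List.Relation.Binary.BagAndSetEquality using (∼bag⇒↭)
open import Data.List.Relation.Binary.Permutation.Propositional as ↭ using (_↭_)
open import Data.List.Relation.Unary.All as All using (All; []; _∷_)
import Data.List.Relation.Unary.All.Properties as All
open import Data.List.Relation.Unary.AllPairs using ([]; _∷_)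
open import Data.List.Relation.Unary.Any using (here; there)
open import Data.List.Relation.Unary.Unique.Propositional using (Unique)
import Data.List.Relation.Unary.Unique.Propositional.Properties as Unique
open import Data.Nat.Base using (ℕ; zero; suc; _+_; _∸_; _≤_; _<_; z≤n; s≤s)
import Data.Nat.Properties as ℕ
open import Data.Product.Base using (∃; _×_; _,_; proj₁; proj₂)
open import Data.Sum.Base as Sum using (_⊎_; inj₁; inj₂; [_,_]′)
open import Data.Vec.Base as Vec using ([]; _∷_; lookup; _[_]≔_; zipWith)
import Data.Vec.Properties as Vec
open import Function.Base using (_∘_; id)
open import Function.Bundles using (mk⇔)
open import Induction.WellFounded using (Acc; acc)
open import Level using (Level)
open import Relation.Binary.Core using (Rel)
open import Relation.Binary.Definitions using (tri<; tri≈; tri>)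
open import Relation.Binary.PropositionalEquality
open import Relation.Binary.Structures using (IsStrictTotalOrder)
open import Relation.Nullary
open import Relation.Nullary.Decidable using (_×-dec_; ¬?; decidable-stable; dec-true)
open import Relation.Unary using (Pred; Decidable)

private
  variable
    n : ℕ
    E A B X Y : Subset n
    e f g : Fin n

-- Elementary facts about finite subsets.

∈-insert⁻ : ∀ (A : Subset n) → g ∈ A ∪ ⁅ e ⁆ → g ∈ A ⊎ g ≡ e
∈-insert⁻ {e = e} A = Sum.map₂ (x∈⁅y⁆⇒x≡y e) ∘ x∈p∪q⁻ A ⁅ e ⁆

∈-insert : ∀ (A : Subset n) e → e ∈ A ∪ ⁅ e ⁆
∈-insert A e = q⊆p∪q A ⁅ e ⁆ (x∈⁅x⁆ e)

insert⊆ : A ⊆ B → e ∈ B → A ∪ ⁅ e ⁆ ⊆ B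
insert⊆ A⊆B e∈B = ∪-lub A⊆B (⁅⁆⊆ e∈B)

insert-mono : A ⊆ B → A ∪ ⁅ e ⁆ ⊆ B ∪ ⁅ e ⁆
insert-mono {B = B} {e = e} A⊆B = insert⊆ (p⊆p∪q ⁅ e ⁆ ∘ A⊆B) (∈-insert B e)

∈-delete⁻ : ∀ (A : Subset n) → g ∈ A - e → g ∈ A × g ≢ e
∈-delete⁻ {e = e} A g∈ = p─q⊆p A ⁅ e ⁆ g∈ ,
  λ { refl → x∈p─q⇒x∉q A ⁅ e ⁆ g∈ (x∈⁅x⁆ e) }

⊆insert-delete : ∀ (A : Subset n) e → A ⊆ (A - e) ∪ ⁅ e ⁆
⊆insert-delete A e {x} x∈A with x ∈? ⁅ e ⁆
... | yes x∈e = q⊆p∪q (A - e) ⁅ e ⁆ x∈e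
... | no  x∉e = p⊆p∪q ⁅ e ⁆ (x∈p∧x∉q⇒x∈p─q x∈A x∉e)

∣insert∣≤ : ∀ (A : Subset n) e → ∣ A ∪ ⁅ e ⁆ ∣ ≤ suc ∣ A ∣
∣insert∣≤ A e = begin
  ∣ A ∪ ⁅ e ⁆ ∣      ≤⟨ ∣p∪q∣≤∣p∣+∣q∣ A ⁅ e ⁆ ⟩
  ∣ A ∣ + ∣ ⁅ e ⁆ ∣  ≡⟨ cong (∣ A ∣ +_) (∣⁅x⁆∣≡1 e) ⟩
  ∣ A ∣ + 1          ≡⟨ ℕ.+-comm ∣ A ∣ 1 ⟩
  suc ∣ A ∣          ∎
  where open ℕ.≤-Reasoning

∣insert∣ : ∀ (A : Subset n) → e ∉ A → ∣ A ∪ ⁅ e ⁆ ∣ ≡ suc ∣ A ∣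
∣insert∣ A e∉A = ℕ.≤-antisym (∣insert∣≤ A _) (∉⇒∣p∣<∣p∪⁅x⁆∣ A e∉A)

disjoint⇒∣p∪q∣≡∣p∣+∣q∣ : (S T : Subset n) → (∀ {x} → x ∈ S → x ∉ T) →
                         ∣ S ∪ T ∣ ≡ ∣ S ∣ + ∣ T ∣
disjoint⇒∣p∪q∣≡∣p∣+∣q∣ S T d =
  ℕ.≤-antisym (∣p∪q∣≤∣p∣+∣q∣ S T) (disjoint⇒∣p∣+∣q∣≤∣p∪q∣ S T d)

⊆∧∣q∣≤∣p∣⇒⊇ : X ⊆ Y → ∣ Y ∣ ≤ ∣ X ∣ → Y ⊆ X
⊆∧∣q∣≤∣p∣⇒⊇ {X = X} X⊆Y Y≤X {x} x∈Y with x ∈? X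
... | yes x∈X = x∈X
... | no  x∉X = contradiction (p⊂q⇒∣p∣<∣q∣ (X⊆Y , x , x∈Y , x∉X)) (ℕ.≤⇒≯ Y≤X)

Empty⇒∣p∣≡0 : {X : Subset n} → Empty X → ∣ X ∣ ≡ 0
Empty⇒∣p∣≡0 {n = n} empty = trans (cong ∣_∣ (Empty-unique empty)) (∣⊥∣≡0 n)

∈-subsets : ∀ (X : Subset n) → X ∈ₗ subsets n
∈-subsets []                  = Membership.∈-++⁺ˡ {xs = [] ∷ []} (Membership.∈-insert [])
∈-subsets {n = suc n} (outside ∷ X) = Membership.∈-++⁺ˡ (Membership.∈-map⁺ (outside ∷_) (∈-subsets X))
∈-subsets {n = suc n} (inside  ∷ X) = Membership.∈-++⁺ʳ (List.map (outside ∷_) (subsets n))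
  (Membership.∈-map⁺ (inside ∷_) (∈-subsets X))

-- Rank, closure and circuits of a matroid.

module Closure {E : Subset n} (N : Matroid E) where
  open Matroid N hiding (Indep; Basis; Circuit; Spanning; rank)
  open MatroidProperties N

  indep≤rank : ∀ {I X} → Indep N I → I ⊆ X → ∣ I ∣ ≤ rank N X
  indep≤rank {I} {X} iI I⊆X = All.lookup (Extrema.xs≤max 0 _) (Membership.∈-map⁺ ∣_∣
    (Membership.∈-filter⁺ (λ J → indep? J ×-dec J ⊆? X) (∈-subsets I) (iI , λ {x} → I⊆X {x})))

  rank-attained : ∀ X → ∃ λ I → Indep N I × I ⊆ X × ∣ I ∣ ≡ rank N X
  rank-attained X with Extrema.argmax-sel id 0
    (List.map ∣_∣ (filter (λ I → indep? I ×-dec I ⊆? X) (subsets n)))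
  -- The maximum is the default value 0, which `⊥` attains.
  ... | inj₁ rank≡0 = ⊥ , ∅-indep , ⊥⊆ , trans (∣⊥∣≡0 n) (sym rank≡0)
  ... | inj₂ rank∈ with I , I∈ , rank≡ ← Membership.∈-map⁻ ∣_∣ rank∈
    with _ , iI , I⊆X ← Membership.∈-filter⁻ (λ J → indep? J ×-dec J ⊆? X) {xs = subsets n} I∈ =
    I , iI , I⊆X , sym rank≡

  rank≤ : ∀ {X k} → (∀ {I} → Indep N I → I ⊆ X → ∣ I ∣ ≤ k) → rank N X ≤ k
  rank≤ {X} bound with I , iI , I⊆X , eq ← rank-attained X = subst (_≤ _) eq (bound iI I⊆X)

  rank-mono : ∀ {X Y} → X ⊆ Y → rank N X ≤ rank N Y
  rank-mono X⊆Y = rank≤ λ iI I⊆X → indep≤rank iI (X⊆Y ∘ I⊆X)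

  rank≤∣∣ : ∀ X → rank N X ≤ ∣ X ∣
  rank≤∣∣ X = rank≤ λ _ I⊆X → p⊆q⇒∣p∣≤∣q∣ I⊆X

  rank-insert≤ : ∀ A e → rank N (A ∪ ⁅ e ⁆) ≤ suc (rank N A)
  rank-insert≤ A e = rank≤ λ {I} iI I⊆ → begin
    ∣ I ∣                  ≤⟨ p⊆q⇒∣p∣≤∣q∣ (⊆insert-delete I e) ⟩
    ∣ (I - e) ∪ ⁅ e ⁆ ∣    ≤⟨ ∣insert∣≤ (I - e) e ⟩
    suc ∣ I - e ∣          ≤⟨ s≤s (indep≤rank (hereditary (p─q⊆p I ⁅ e ⁆) iI)
      λ x∈ → let x∈I , x≢e = ∈-delete⁻ I x∈ in [ id , (λ x≡e → contradiction x≡e x≢e) ]′ (∈-insert⁻ A (I⊆ x∈I))) ⟩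
    suc (rank N A)         ∎
    where open ℕ.≤-Reasoning

  rank≡∣∣⇒indep : ∀ {X} → rank N X ≡ ∣ X ∣ → Indep N X
  rank≡∣∣⇒indep {X} eq with I , iI , I⊆X , eq′ ← rank-attained X =
    hereditary (⊆∧∣q∣≤∣p∣⇒⊇ I⊆X (ℕ.≤-reflexive (trans (sym eq) (sym eq′)))) iI

  indep⇒rank≡∣∣ : ∀ {X} → Indep N X → rank N X ≡ ∣ X ∣
  indep⇒rank≡∣∣ iX = ℕ.≤-antisym (rank≤∣∣ _) (indep≤rank iX id)

  infix 4 _∈cl_ _∈cl?_

  _∈cl_ : Fin n → Subset n → Set
  e ∈cl A = rank N (A ∪ ⁅ e ⁆) ≡ rank N A

  _∈cl?_ : ∀ e A → Dec (e ∈cl A)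
  e ∈cl? A = rank N (A ∪ ⁅ e ⁆) ℕ.≟ rank N A

  rank-insert≤⇒∈cl : rank N (A ∪ ⁅ e ⁆) ≤ rank N A → e ∈cl A
  rank-insert≤⇒∈cl {e = e} r≤ = ℕ.≤-antisym r≤ (rank-mono (p⊆p∪q ⁅ e ⁆))

  ∉cl⇒rank-insert : ¬ e ∈cl A → rank N (A ∪ ⁅ e ⁆) ≡ suc (rank N A)
  ∉cl⇒rank-insert e∉ = ℕ.≤-antisym (rank-insert≤ _ _) (ℕ.≰⇒> (e∉ ∘ rank-insert≤⇒∈cl))

  ∈⇒∈cl : e ∈ A → e ∈cl A
  ∈⇒∈cl e∈A = rank-insert≤⇒∈cl (rank-mono (insert⊆ id e∈A))

  -- Suppose `e` raised the rank of `B`. A maximal independent `I` in `A` extends to a maximal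
  -- independent `K` in `B`, and `K` can then be augmented by some `g` from a larger independent
  -- subset of `B ∪ ⁅ e ⁆`. If `g` lies in `B`, the rank of `B` is exceeded; if `g` is `e`, then
  -- `I ∪ ⁅ e ⁆` is independent and exceeds the rank of `A ∪ ⁅ e ⁆`.
  cl-mono : A ⊆ B → e ∈cl A → e ∈cl B
  cl-mono {A} {B} {e} A⊆B e∈clA = rank-insert≤⇒∈cl (ℕ.≮⇒≥ absurd)
    where
    absurd : ¬ (rank N B < rank N (B ∪ ⁅ e ⁆))
    absurd r<
      with I , iI , I⊆A , ∣I∣≡ ← rank-attained A
      with J , iJ , J⊆B , ∣J∣≡ ← rank-attained B
      with K , iK , I⊆K , K⊆ , J≤K ← extendWithin iI iJ
      with L , iL , L⊆ , ∣L∣≡ ← rank-attained (B ∪ ⁅ e ⁆)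
      with K⊆B ← (λ {x} → ∪-lub {S = I} (A⊆B ∘ I⊆A) J⊆B {x} ∘ K⊆)
      with g , g∈L , g∉K , iK∪g ← augmentation iK iL
             (subst (∣ K ∣ <_) (sym ∣L∣≡) (ℕ.≤-<-trans (indep≤rank iK K⊆B) r<))
      with ∈-insert⁻ B (L⊆ g∈L)
    ... | inj₁ g∈B = ℕ.<-irrefl refl (begin-strict
      rank N B       ≡⟨ ∣J∣≡ ⟨
      ∣ J ∣          ≤⟨ J≤K ⟩
      ∣ K ∣          <⟨ ∉⇒∣p∣<∣p∪⁅x⁆∣ K g∉K ⟩
      ∣ K ∪ ⁅ g ⁆ ∣  ≤⟨ indep≤rank iK∪g (insert⊆ K⊆B g∈B) ⟩
      rank N B       ∎)
      where open ℕ.≤-Reasoning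
    ... | inj₂ refl = ℕ.<-irrefl refl (begin-strict
      rank N A            ≡⟨ ∣I∣≡ ⟨
      ∣ I ∣               <⟨ ∉⇒∣p∣<∣p∪⁅x⁆∣ I (g∉K ∘ I⊆K) ⟩
      ∣ I ∪ ⁅ e ⁆ ∣       ≤⟨ indep≤rank (hereditary (insert-mono I⊆K) iK∪g) (insert-mono I⊆A) ⟩
      rank N (A ∪ ⁅ e ⁆)  ≡⟨ e∈clA ⟩
      rank N A            ∎)
      where open ℕ.≤-Reasoning

  private
    insert-swap : ∀ (A : Subset n) e f → (A ∪ ⁅ e ⁆) ∪ ⁅ f ⁆ ⊆ (A ∪ ⁅ f ⁆) ∪ ⁅ e ⁆
    insert-swap A e f = insert⊆ (insert-mono (p⊆p∪q ⁅ f ⁆)) (p⊆p∪q ⁅ e ⁆ (∈-insert A f))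

  cl-absorb : f ∈cl A → e ∈cl A ∪ ⁅ f ⁆ → e ∈cl A
  cl-absorb {f} {A} {e} f∈ e∈ = rank-insert≤⇒∈cl (begin
    rank N (A ∪ ⁅ e ⁆)            ≤⟨ rank-mono (insert-mono (p⊆p∪q ⁅ f ⁆)) ⟩
    rank N ((A ∪ ⁅ f ⁆) ∪ ⁅ e ⁆)  ≡⟨ e∈ ⟩
    rank N (A ∪ ⁅ f ⁆)            ≡⟨ f∈ ⟩
    rank N A                      ∎)
    where open ℕ.≤-Reasoning

  -- Adding `f` to `A` raises the rank by at most one, and adding `e` alone already raises it by
  -- one.
  exchange : e ∈cl A ∪ ⁅ f ⁆ → ¬ e ∈cl A → f ∈cl A ∪ ⁅ e ⁆
  exchange {e} {A} {f} e∈ e∉ = rank-insert≤⇒∈cl (begin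
    rank N ((A ∪ ⁅ e ⁆) ∪ ⁅ f ⁆)  ≤⟨ rank-mono (insert-swap A e f) ⟩
    rank N ((A ∪ ⁅ f ⁆) ∪ ⁅ e ⁆)  ≡⟨ e∈ ⟩
    rank N (A ∪ ⁅ f ⁆)            ≤⟨ rank-insert≤ A f ⟩
    suc (rank N A)                ≡⟨ ∉cl⇒rank-insert e∉ ⟨
    rank N (A ∪ ⁅ e ⁆)            ∎)
    where open ℕ.≤-Reasoning

  -- `C - e` is independent, so its rank is its size. An independent subset of `(C - e) ∪ ⁅ e ⁆`
  -- larger than that would contain all of `C`.
  circuit⇒∈cl : ∀ {C} → Circuit N C → e ∈ C → e ∈cl C - e
  circuit⇒∈cl {e} {C} (_ , ¬iC , min) e∈C = rank-insert≤⇒∈cl (rank≤ λ {I} iI I⊆ → begin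
    ∣ I ∣             ≤⟨ ℕ.≤-pred (I<1+C-e iI I⊆) ⟩
    ∣ C - e ∣         ≡⟨ indep⇒rank≡∣∣ (min (C - e) (x∈p⇒p-x⊂p e∈C)) ⟨
    rank N (C - e)    ∎)
    where
    open ℕ.≤-Reasoning
    I<1+C-e : ∀ {I} → Indep N I → I ⊆ (C - e) ∪ ⁅ e ⁆ → ∣ I ∣ < suc ∣ C - e ∣
    I<1+C-e {I} iI I⊆ = ℕ.≰⇒> λ 1+C-e≤I →
      ¬iC (hereditary (⊆∧∣q∣≤∣p∣⇒⊇ I⊆ (ℕ.≤-trans (∣insert∣≤ (C - e) e) 1+C-e≤I)
        ∘ ⊆insert-delete C e) iI)

  dependent⇒circuit : ∀ {D} → D ⊆ E → ¬ Indep N D → ∃ λ C → Circuit N C × C ⊆ D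
  dependent⇒circuit {D} = go (⊂-wellFounded D)
    where
    go : ∀ {D} → Acc _⊂_ D → D ⊆ E → ¬ Indep N D → ∃ λ C → Circuit N C × C ⊆ D
    go {D} (acc rec) D⊆E ¬iD with anySubset? (λ J → J ⊂? D ×-dec ¬? (indep? J))
    ... | no ∄J = D , (D⊆E , ¬iD , λ J J⊂D → decidable-stable (indep? J) λ ¬iJ → ∄J (J , J⊂D , ¬iJ)) , id
    ... | yes (J , J⊂D , ¬iJ) with C , cC , C⊆J ← go (rec J⊂D) (D⊆E ∘ proj₁ J⊂D) ¬iJ =
      C , cC , proj₁ J⊂D ∘ C⊆J

  -- A maximal independent `I` in `A` becomes dependent when `e` is added, since the rank does not
  -- grow. The resulting circuit contains `e`, as otherwise it would lie inside `I`.
  ∈cl⇒circuit : e ∈ E → e ∉ A → e ∈cl A → ∃ λ C → Circuit N C × C ⊆ A ∪ ⁅ e ⁆ × e ∈ C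
  ∈cl⇒circuit {e} {A} e∈E e∉A e∈cl
    with I , iI , I⊆A , ∣I∣≡ ← rank-attained A
    with C , cC , C⊆ ← dependent⇒circuit (insert⊆ (⊆ground iI) e∈E) (λ iI∪e →
           ℕ.<-irrefl refl (ℕ.<-≤-trans (∉⇒∣p∣<∣p∪⁅x⁆∣ I (e∉A ∘ I⊆A))
             (ℕ.≤-trans (indep≤rank iI∪e (insert-mono I⊆A)) (ℕ.≤-reflexive (trans e∈cl (sym ∣I∣≡))))))
    with e ∈? C
  ... | yes e∈C = C , cC , insert-mono I⊆A ∘ C⊆ , e∈C
  ... | no  e∉C = ⊥-elim (proj₁ (proj₂ cC) (hereditary
    (λ x∈C → [ id , (λ { refl → contradiction x∈C e∉C }) ]′ (∈-insert⁻ I (C⊆ x∈C))) iI))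

  ∣basis∣ : ∀ {B} → Basis N B → ∣ B ∣ ≡ r N
  ∣basis∣ bB = ℕ.≤-antisym (indep≤rank (proj₁ bB) (⊆ground (proj₁ bB)))
    (rank≤ λ iI _ → indep≤basis iI bB)

-- Duality: ranks and orthogonality.

module Dual {E : Subset n} (N : Matroid E) where
  open Matroid N hiding (Indep; Basis; Circuit; Spanning; rank)
  open MatroidProperties N
  open Closure N
  module ⋆ = Closure (N ⋆)

  -- For `≤-part`, a basis `B` disjoint from a maximal coindependent `I` in `A` is split: `B ∩ A`
  -- shares `A` with `I`, and `B ─ A` is independent in `E ─ A`. For `≥-part`, a maximal independent
  -- `J` in `E ─ A` is extended to a basis `K`: `A ─ K` is coindependent, and `A ∩ K` and `J` are
  -- disjoint parts of `K`.
  dual-rank : A ⊆ E → rank (N ⋆) A + r N ≡ ∣ A ∣ + rank N (E ─ A)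
  dual-rank {A} A⊆E = ℕ.≤-antisym ≤-part ≥-part
    where
    open ℕ.≤-Reasoning

    ≤-part : rank (N ⋆) A + r N ≤ ∣ A ∣ + rank N (E ─ A)
    ≤-part with I , (B , bB , I⊆E─B) , I⊆A , ∣I∣≡ ← ⋆.rank-attained A = begin
      rank (N ⋆) A + r N                        ≡⟨ cong₂ _+_ ∣I∣≡ (∣basis∣ bB) ⟨
      ∣ I ∣ + ∣ B ∣                             ≤⟨ ℕ.+-monoʳ-≤ ∣ I ∣
        (ℕ.≤-trans (p⊆q⇒∣p∣≤∣q∣ B⊆) (∣p∪q∣≤∣p∣+∣q∣ (B ∩ A) (B ─ A))) ⟩
      ∣ I ∣ + (∣ B ∩ A ∣ + ∣ B ─ A ∣)           ≡⟨ ℕ.+-assoc ∣ I ∣ _ _ ⟨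
      (∣ I ∣ + ∣ B ∩ A ∣) + ∣ B ─ A ∣           ≤⟨ ℕ.+-mono-≤
        (ℕ.≤-trans (disjoint⇒∣p∣+∣q∣≤∣p∪q∣ I (B ∩ A) λ x∈I x∈ → x∈p─q⇒x∉q E B (I⊆E─B x∈I) (p∩q⊆p B A x∈))
          (p⊆q⇒∣p∣≤∣q∣ (∪-lub I⊆A (p∩q⊆q B A))))
        (indep≤rank (hereditary (p─q⊆p B A) (proj₁ bB))
          λ x∈ → x∈p∧x∉q⇒x∈p─q (⊆ground (proj₁ bB) (p─q⊆p B A x∈)) (x∈p─q⇒x∉q B A x∈)) ⟩
      ∣ A ∣ + rank N (E ─ A)                    ∎
      where
      B⊆ : B ⊆ (B ∩ A) ∪ (B ─ A)
      B⊆ {x} x∈B with x ∈? A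
      ... | yes x∈A = p⊆p∪q (B ─ A) (x∈p∩q⁺ (x∈B , x∈A))
      ... | no  x∉A = q⊆p∪q (B ∩ A) (B ─ A) (x∈p∧x∉q⇒x∈p─q x∈B x∉A)

    ≥-part : ∣ A ∣ + rank N (E ─ A) ≤ rank (N ⋆) A + r N
    ≥-part
      with J , iJ , J⊆ , ∣J∣≡ ← rank-attained (E ─ A)
      with B , bB ← ∃basis
      with K , iK , J⊆K , _ , B≤K ← extendWithin iJ (proj₁ bB) = begin
      ∣ A ∣ + rank N (E ─ A)                    ≡⟨ cong (∣ A ∣ +_) ∣J∣≡ ⟨
      ∣ A ∣ + ∣ J ∣                             ≤⟨ ℕ.+-monoˡ-≤ ∣ J ∣
        (ℕ.≤-trans (p⊆q⇒∣p∣≤∣q∣ A⊆) (∣p∪q∣≤∣p∣+∣q∣ (A ─ K) (A ∩ K))) ⟩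
      (∣ A ─ K ∣ + ∣ A ∩ K ∣) + ∣ J ∣           ≡⟨ ℕ.+-assoc ∣ A ─ K ∣ _ _ ⟩
      ∣ A ─ K ∣ + (∣ A ∩ K ∣ + ∣ J ∣)           ≤⟨ ℕ.+-mono-≤
        (⋆.indep≤rank (K , large⇒basis iK bB B≤K ,
          λ x∈ → x∈p∧x∉q⇒x∈p─q (A⊆E (p─q⊆p A K x∈)) (x∈p─q⇒x∉q A K x∈)) (p─q⊆p A K))
        (ℕ.≤-trans (disjoint⇒∣p∣+∣q∣≤∣p∪q∣ (A ∩ K) J λ x∈ x∈J → x∈p─q⇒x∉q E A (J⊆ x∈J) (p∩q⊆p A K x∈))
          (p⊆q⇒∣p∣≤∣q∣ (∪-lub (p∩q⊆q A K) J⊆K))) ⟩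
      rank (N ⋆) A + ∣ K ∣                      ≤⟨ ℕ.+-monoʳ-≤ (rank (N ⋆) A) (indep≤rank iK (⊆ground iK)) ⟩
      rank (N ⋆) A + r N                        ∎
      where
      A⊆ : A ⊆ (A ─ K) ∪ (A ∩ K)
      A⊆ {x} x∈A with x ∈? K
      ... | yes x∈K = q⊆p∪q (A ─ K) (A ∩ K) (x∈p∩q⁺ (x∈A , x∈K))
      ... | no  x∉K = p⊆p∪q (A ∩ K) (x∈p∧x∉q⇒x∈p─q x∈A x∉K)

  -- The closure form of the fact that a circuit and a cocircuit never meet in exactly one element.
  -- By `dual-rank`, `e` in the dual closure of `A′` means that removing `e` from `E ─ A′` lowers
  -- the rank. What remains contains `A`, so it still has `e` in its closure.
  orthogonal : ∀ {A A′} → e ∈ E → A ⊆ E → A′ ⊆ E → e ∉ A → e ∉ A′ →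
               (∀ {x} → x ∈ A → x ∉ A′) → e ∈cl A → ¬ e ⋆.∈cl A′
  orthogonal {e} {A} {A′} e∈E A⊆E A′⊆E e∉A e∉A′ A#A′ e∈cl e∈cl⋆ = ℕ.<-irrefl refl (begin-strict
    rank N S′             <⟨ ℕ.≤-reflexive (ℕ.+-cancelˡ-≡ ∣ A′ ∣ _ _ count) ⟩
    rank N (E ─ A′)       ≤⟨ rank-mono S⊆ ⟩
    rank N (S′ ∪ ⁅ e ⁆)   ≡⟨ cl-mono A⊆S′ e∈cl ⟩
    rank N S′             ∎)
    where
    open ℕ.≤-Reasoning
    S′ = E ─ (A′ ∪ ⁅ e ⁆)

    count : ∣ A′ ∣ + suc (rank N S′) ≡ ∣ A′ ∣ + rank N (E ─ A′)
    count = begin-equality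
      ∣ A′ ∣ + suc (rank N S′)            ≡⟨ ℕ.+-suc ∣ A′ ∣ _ ⟩
      suc ∣ A′ ∣ + rank N S′              ≡⟨ cong (_+ rank N S′) (∣insert∣ A′ e∉A′) ⟨
      ∣ A′ ∪ ⁅ e ⁆ ∣ + rank N S′          ≡⟨ dual-rank (insert⊆ A′⊆E e∈E) ⟨
      rank (N ⋆) (A′ ∪ ⁅ e ⁆) + r N       ≡⟨ cong (_+ r N) e∈cl⋆ ⟩
      rank (N ⋆) A′ + r N                 ≡⟨ dual-rank A′⊆E ⟩
      ∣ A′ ∣ + rank N (E ─ A′)            ∎

    A⊆S′ : A ⊆ S′
    A⊆S′ x∈A = x∈p∧x∉q⇒x∈p─q (A⊆E x∈A)
      ([ A#A′ x∈A , (λ { refl → e∉A x∈A }) ]′ ∘ ∈-insert⁻ A′)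

    S⊆ : E ─ A′ ⊆ S′ ∪ ⁅ e ⁆
    S⊆ {x} x∈ with x ∈? ⁅ e ⁆
    ... | yes x∈e = q⊆p∪q S′ ⁅ e ⁆ x∈e
    ... | no  x∉e = p⊆p∪q ⁅ e ⁆ (x∈p∧x∉q⇒x∈p─q (p─q⊆p E A′ x∈)
      ([ x∈p─q⇒x∉q E A′ x∈ , x∉e ]′ ∘ x∈p∪q⁻ A′ ⁅ e ⁆))

-- The case of `dual-rank` for `N ↾ X` where `A` is the whole ground set: the rank of the dual is
-- the nullity of `X`.
rank-dual-restriction : {E : Subset n} (N : Matroid E) (X : Subset n) →
                        r ((N ↾ X) ⋆) + rank N X ≡ ∣ X ∣
rank-dual-restriction N X = begin
  r ((N ↾ X) ⋆) + rank N X           ≡⟨ cong (r ((N ↾ X) ⋆) +_) restrict ⟩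
  r ((N ↾ X) ⋆) + r (N ↾ X)          ≡⟨ Dual.dual-rank (N ↾ X) id ⟩
  ∣ X ∣ + rank (N ↾ X) (X ─ X)       ≡⟨ cong (∣ X ∣ +_) (ℕ.n≤0⇒n≡0
    (ℕ.≤-trans (Closure.rank≤∣∣ (N ↾ X) (X ─ X)) (ℕ.≤-reflexive (Empty⇒∣p∣≡0 empty)))) ⟩
  ∣ X ∣ + 0                          ≡⟨ ℕ.+-identityʳ ∣ X ∣ ⟩
  ∣ X ∣                              ∎
  where
  open ≡-Reasoning
  restrict : rank N X ≡ r (N ↾ X)
  restrict = ℕ.≤-antisym
    (Closure.rank≤ N λ iI I⊆X → Closure.indep≤rank (N ↾ X) (iI , λ {x} → I⊆X {x}) I⊆X)
    (Closure.rank≤ (N ↾ X) λ (iI , _) I⊆X → Closure.indep≤rank N iI I⊆X)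

  empty : Empty (X ─ X)
  empty (x , x∈) = x∈p─q⇒x∉q X X x∈ (p─q⊆p X X x∈)

-- Closures in a matroid perspective.

∈-⋃⁻ : {P : Subset n → Set} → ∀ {Ds} → All P Ds → e ∈ ⋃ Ds → ∃ λ D → P D × D ⊆ ⋃ Ds × e ∈ D
∈-⋃⁻ [] e∈ = contradiction e∈ ∉⊥
∈-⋃⁻ {Ds = D ∷ Ds} (pD ∷ pDs) e∈ with x∈p∪q⁻ D (⋃ Ds) e∈
... | inj₁ e∈D = D , pD , p⊆p∪q (⋃ Ds) , e∈D
... | inj₂ e∈Ds with D′ , pD′ , D′⊆ , e∈D′ ← ∈-⋃⁻ pDs e∈Ds =
  D′ , pD′ , q⊆p∪q D (⋃ Ds) ∘ D′⊆ , e∈D′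

-- An `M`-circuit through `e` inside `A ∪ ⁅ e ⁆` is a union of `M′`-circuits, one of which passes
-- through `e`. The hypothesis `Perspective` enters the proof here.
perspective⇒cl⊆ : {E : Subset n} (M M′ : Matroid E) → Perspective M M′ →
                  e ∈ E → Closure._∈cl_ M e A → Closure._∈cl_ M′ e A
perspective⇒cl⊆ {e = e} {A} M M′ persp e∈E e∈cl with e ∈? A
... | yes e∈A = Closure.∈⇒∈cl M′ e∈A
... | no  e∉A
  with C , cC , C⊆ , e∈C ← Closure.∈cl⇒circuit M e∈E e∉A e∈cl
  with Ds , cDs , refl ← persp C cC
  with D , cD , D⊆ , e∈D ← ∈-⋃⁻ cDs e∈C =
  Closure.cl-mono M′
    (λ x∈ → let x∈D , x≢e = ∈-delete⁻ D x∈ in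
      [ id , (λ x≡e → contradiction x≡e x≢e) ]′ (∈-insert⁻ A (C⊆ (D⊆ x∈D))))
    (Closure.circuit⇒∈cl M′ cD e∈D)

-- Membership bits and complements.

∈-separate⁺ : ∀ {p} {P : Pred (Fin n) p} (P? : Decidable P) → P e → e ∈ separate P?
∈-separate⁺ {e = e} P? pe = Vec.lookup⇒[]= e _
  (trans (Vec.lookup∘tabulate (does ∘ P?) e) (dec-true (P? e) pe))

∈-separate⁻ : ∀ {p} {P : Pred (Fin n) p} (P? : Decidable P) → e ∈ separate P? → P e
∈-separate⁻ {e = e} P? e∈ with P? e | trans (sym (Vec.lookup∘tabulate (does ∘ P?) e)) (Vec.[]=⇒lookup e∈)
... | yes pe | _ = pe

lookup-ext : ∀ (X Y : Subset n) → (∀ g → lookup X g ≡ lookup Y g) → X ≡ Y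
lookup-ext X Y eq = trans (sym (Vec.tabulate∘lookup X)) (trans (Vec.tabulate-cong eq) (Vec.tabulate∘lookup Y))

∈-lookup : lookup X g ≡ lookup Y g → g ∈ X → g ∈ Y
∈-lookup {g = g} eq g∈X = Vec.lookup⇒[]= g _ (trans (sym eq) (Vec.[]=⇒lookup g∈X))

p─[p─q]≡q : X ⊆ E → E ─ (E ─ X) ≡ X
p─[p─q]≡q {X = X} {E} X⊆E = ⊆-antisym ⊆X λ x∈X →
  x∈p∧x∉q⇒x∈p─q (X⊆E x∈X) λ x∈ → x∈p─q⇒x∉q E X x∈ x∈X
  where
  ⊆X : E ─ (E ─ X) ⊆ X
  ⊆X {x} x∈ with x ∈? X
  ... | yes x∈X = x∈X
  ... | no  x∉X = contradiction (x∈p∧x∉q⇒x∈p─q (p─q⊆p E (E ─ X) x∈) x∉X) (x∈p─q⇒x∉q E (E ─ X) x∈)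

q⊆p⇒p∩q≡q : B ⊆ A → A ∩ B ≡ B
q⊆p⇒p∩q≡q {B = B} {A} B⊆A = ⊆-antisym (p∩q⊆q A B) λ x∈B → x∈p∩q⁺ (B⊆A x∈B , x∈B)

-- Active elements with respect to an order.

module Order {n ℓ} {_<_ : Rel (Fin n) ℓ} (<-sto : IsStrictTotalOrder _≡_ _<_) where
  open IsStrictTotalOrder <-sto using (_<?_; compare; irrefl; asym; isStrictPartialOrder)

  minimum : ∀ X → Nonempty X → ∃ λ e → IsMin <-sto e X
  minimum X (x , x∈X) = go (spo-wellFounded isStrictPartialOrder x) x∈X
    where
    go : ∀ {x} → Acc _<_ x → x ∈ X → ∃ λ e → IsMin <-sto e X
    go {x} (acc rec) x∈X with any? (λ y → y ∈? X ×-dec y <? x)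
    ... | yes (y , y∈X , y<x) = go (rec y<x) y∈X
    ... | no  ∄y = x , x∈X , λ y y∈X y<x → ∄y (y , y∈X , y<x)

  opaque
    above : Fin n → Subset n
    above e = separate (e <?_)

    ∈-above⁺ : e < f → f ∈ above e
    ∈-above⁺ = ∈-separate⁺ (_ <?_)

    ∈-above⁻ : f ∈ above e → e < f
    ∈-above⁻ = ∈-separate⁻ (_ <?_)

  ∈-∩above⁻ : f ∈ X ∩ above e → f ∈ X × e < f
  ∈-∩above⁻ {X = X} {e} f∈ = let f∈X , f∈ = x∈p∩q⁻ X (above e) f∈ in f∈X , ∈-above⁻ f∈

  ∩above-cong : (∀ {g} → e < g → lookup X g ≡ lookup Y g) → X ∩ above e ≡ Y ∩ above e
  ∩above-cong {e} {X} {Y} eq = ⊆-antisym (half X Y eq) (half Y X (sym ∘ eq))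
    where
    half : ∀ X Y → (∀ {g} → e < g → lookup X g ≡ lookup Y g) → X ∩ above e ⊆ Y ∩ above e
    half X Y eq x∈ = let x∈X , e<x = ∈-∩above⁻ x∈ in
      x∈p∩q⁺ (∈-lookup (eq e<x) x∈X , ∈-above⁺ e<x)

  module Active {E : Subset n} (N : Matroid E) where
    open Closure N

    -- Whether `e` lies in `X` does not matter, so one notion serves elements inside and outside of
    -- `X`. The condition `e ∈ E` excludes elements outside the ground set, which never raise a rank
    -- and so lie in every closure.
    active? : ∀ X → Decidable λ e → e ∈ E × e ∈cl X ∩ above e
    active? X e = e ∈? E ×-dec e ∈cl? (X ∩ above e)

    opaque
      active : Subset n → Subset n
      active X = separate (active? X)

      active⁺ : e ∈ E → e ∈cl X ∩ above e → e ∈ active X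
      active⁺ e∈E e∈cl = ∈-separate⁺ (active? _) (e∈E , e∈cl)

      active⁻ : e ∈ active X → e ∈ E × e ∈cl X ∩ above e
      active⁻ = ∈-separate⁻ (active? _)

    active⊆ : active X ⊆ E
    active⊆ = proj₁ ∘ active⁻

    active-local : X ∩ above e ≡ Y ∩ above e → e ∈ active X → e ∈ active Y
    active-local eq e∈ = let e∈E , e∈cl = active⁻ e∈ in active⁺ e∈E (subst (_ ∈cl_) eq e∈cl)

    -- As `e` is the minimum of `C`, the set `C - e` lies in `X ∩ above e`. With the converse below,
    -- activity is the circuit condition that occurs in `Int` and `Ext`.
    circuit⇒active : ContainsCircuitWithMin <-sto N (X ∪ ⁅ e ⁆) e → e ∈ active X
    circuit⇒active {X} {e} (C , cC , C⊆ , e∈C , min) = active⁺ (proj₁ cC e∈C) (cl-mono C-e⊆ (circuit⇒∈cl cC e∈C))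
      where
      C-e⊆ : C - e ⊆ X ∩ above e
      C-e⊆ {x} x∈ with x∈C , x≢e ← ∈-delete⁻ C x∈ with ∈-insert⁻ X (C⊆ x∈C) | compare x e
      ... | inj₂ x≡e | _           = contradiction x≡e x≢e
      ... | inj₁ _   | tri< x<e _ _ = contradiction x<e (min x x∈C)
      ... | inj₁ _   | tri≈ _ x≡e _ = contradiction x≡e x≢e
      ... | inj₁ x∈X | tri> _ _ e<x = x∈p∩q⁺ (x∈X , ∈-above⁺ e<x)

    active⇒circuit : e ∈ active X → ContainsCircuitWithMin <-sto N (X ∪ ⁅ e ⁆) e
    active⇒circuit {e} {X} e∈
      with e∈E , e∈cl ← active⁻ e∈
      with C , cC , C⊆ , e∈C ← ∈cl⇒circuit e∈E (λ e∈A → irrefl refl (proj₂ (∈-∩above⁻ e∈A))) e∈cl =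
      C , cC , insert-mono (p∩q⊆p X (above e)) ∘ C⊆ , e∈C ,
      λ f f∈C f<e → [ (λ f∈ → asym f<e (proj₂ (∈-∩above⁻ f∈))) , (λ { refl → irrefl refl f<e }) ]′
        (∈-insert⁻ (X ∩ above e) (C⊆ f∈C))

    -- A circuit contained in `(E ─ Y) ∪ ⁅ e ⁆` with `e` in both it and `Y` is one that meets `Y` in
    -- `e` only. Hence compatibility of `Y` speaks of the active elements of its complement.
    compatible⇒ : Compatible <-sto N Y → e ∈ active (E ─ Y) → e ∉ Y
    compatible⇒ {Y} {e} (Y⊆E , ∄C) e∈ e∈Y with C , cC , C⊆ , min ← active⇒circuit e∈ =
      ∄C (C , cC , e , min , ⊆-antisym ⊆e (⁅⁆⊆ (x∈p∩q⁺ (e∈Y , proj₁ min))))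
      where
      ⊆e : Y ∩ C ⊆ ⁅ e ⁆
      ⊆e x∈ = let x∈Y , x∈C = x∈p∩q⁻ Y C x∈ in
        [ (λ x∈ → contradiction x∈Y (x∈p─q⇒x∉q E Y x∈)) , id ]′ (x∈p∪q⁻ (E ─ Y) ⁅ e ⁆ (C⊆ x∈C))

    compatible⇐ : Y ⊆ E → (∀ {e} → e ∈ active (E ─ Y) → e ∉ Y) → Compatible <-sto N Y
    compatible⇐ {Y} Y⊆E avoid = Y⊆E , λ (C , cC , e , min , Y∩C≡e) →
      avoid (circuit⇒active (C , cC , C⊆ C e cC Y∩C≡e , min))
        (p∩q⊆p Y C (subst (e ∈_) (sym Y∩C≡e) (x∈⁅x⁆ e)))
      where
      C⊆ : ∀ C e → Circuit N C → Y ∩ C ≡ ⁅ e ⁆ → C ⊆ (E ─ Y) ∪ ⁅ e ⁆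
      C⊆ C e cC eq {x} x∈C with x ∈? Y
      ... | yes x∈Y = q⊆p∪q (E ─ Y) ⁅ e ⁆ (subst (x ∈_) eq (x∈p∩q⁺ (x∈Y , x∈C)))
      ... | no  x∉Y = p⊆p∪q ⁅ e ⁆ (x∈p∧x∉q⇒x∈p─q (proj₁ cC x∈C) x∉Y)

    -- Adding the elements of X one at a time from the largest to the smallest,
    -- the rank grows exactly at those that are not active.
    rank+∣active∣ : ∀ {X} → X ⊆ E → rank N X + ∣ X ∩ active X ∣ ≡ ∣ X ∣
    rank+∣active∣ {X} = go (⊂-wellFounded X)
      where
      open ≡-Reasoning
      go : ∀ {X} → Acc _⊂_ X → X ⊆ E → rank N X + ∣ X ∩ active X ∣ ≡ ∣ X ∣
      go {X} (acc rec) X⊆E with nonempty? X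
      ... | no empty = cong₂ _+_ (ℕ.n≤0⇒n≡0 (ℕ.≤-trans (rank≤∣∣ X) ∣X∣≤0))
                                 (ℕ.≤-antisym (p⊆q⇒∣p∣≤∣q∣ (p∩q⊆p X (active X)))
                                   (ℕ.≤-trans ∣X∣≤0 z≤n))
        where
        ∣X∣≤0 : ∣ X ∣ ≤ 0
        ∣X∣≤0 = ℕ.≤-reflexive (Empty⇒∣p∣≡0 empty)
      ... | yes nonempty with m , m∈X , min ← minimum X nonempty = result
        where
        X′ = X - m

        m∉X′ : m ∉ X′
        m∉X′ m∈ = proj₂ (∈-delete⁻ X m∈) refl

        IH : rank N X′ + ∣ X′ ∩ active X′ ∣ ≡ ∣ X′ ∣
        IH = go (rec (x∈p⇒p-x⊂p m∈X)) (X⊆E ∘ p─q⊆p X ⁅ m ⁆)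

        X≡ : X ≡ X′ ∪ ⁅ m ⁆
        X≡ = ⊆-antisym (⊆insert-delete X m) (insert⊆ (p─q⊆p X ⁅ m ⁆) m∈X)

        m<X′ : ∀ {x} → x ∈ X′ → m < x
        m<X′ {x} x∈ with x∈X , x≢m ← ∈-delete⁻ X x∈ with compare m x
        ... | tri< m<x _ _ = m<x
        ... | tri≈ _ m≡x _ = contradiction (sym m≡x) x≢m
        ... | tri> _ _ x<m = contradiction x<m (min x x∈X)

        -- Since `m` is the minimum, it is active exactly when it lies in the closure of all of
        -- `X′`; the activity of larger elements does not see `m`.
        above-m : X ∩ above m ≡ X′
        above-m = ⊆-antisym
          (λ x∈ → let x∈X , m<x = ∈-∩above⁻ x∈ in
            x∈p∧x≢y⇒x∈p-y x∈X λ { refl → irrefl refl m<x })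
          (λ x∈ → x∈p∩q⁺ (p─q⊆p X ⁅ m ⁆ x∈ , ∈-above⁺ (m<X′ x∈)))

        above-X′ : ∀ {x} → x ∈ X′ → X ∩ above x ≡ X′ ∩ above x
        above-X′ {x} x∈ = ⊆-antisym
          (λ y∈ → let y∈X , x<y = ∈-∩above⁻ y∈ in
            x∈p∩q⁺ (x∈p∧x≢y⇒x∈p-y y∈X (λ { refl → asym x<y (m<X′ x∈) }) , ∈-above⁺ x<y))
          (λ y∈ → let y∈X′ , x<y = ∈-∩above⁻ y∈ in
            x∈p∩q⁺ (p─q⊆p X ⁅ m ⁆ y∈X′ , ∈-above⁺ x<y))

        ⊇active : X′ ∩ active X′ ⊆ X ∩ active X
        ⊇active x∈ = let x∈X′ , x∈a = x∈p∩q⁻ X′ (active X′) x∈ in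
          x∈p∩q⁺ (p─q⊆p X ⁅ m ⁆ x∈X′ , active-local (sym (above-X′ x∈X′)) x∈a)

        ⊆active : ∀ {x} → x ∈ X ∩ active X → x ≢ m → x ∈ X′ ∩ active X′
        ⊆active x∈ x≢m = let x∈X , x∈a = x∈p∩q⁻ X (active X) x∈
                             x∈X′ = x∈p∧x≢y⇒x∈p-y x∈X x≢m in
          x∈p∩q⁺ (x∈X′ , active-local (above-X′ x∈X′) x∈a)

        result : rank N X + ∣ X ∩ active X ∣ ≡ ∣ X ∣
        result with m ∈cl? X′
        ... | yes m∈cl = begin
          rank N X + ∣ X ∩ active X ∣               ≡⟨ cong₂ (λ S T → rank N S + ∣ T ∣) X≡ active≡ ⟩
          rank N (X′ ∪ ⁅ m ⁆) + ∣ (X′ ∩ active X′) ∪ ⁅ m ⁆ ∣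
            ≡⟨ cong₂ _+_ m∈cl (∣insert∣ (X′ ∩ active X′) (m∉X′ ∘ p∩q⊆p X′ (active X′))) ⟩
          rank N X′ + suc ∣ X′ ∩ active X′ ∣        ≡⟨ ℕ.+-suc _ _ ⟩
          suc (rank N X′ + ∣ X′ ∩ active X′ ∣)      ≡⟨ cong suc IH ⟩
          suc ∣ X′ ∣                                ≡⟨ ∣insert∣ X′ m∉X′ ⟨
          ∣ X′ ∪ ⁅ m ⁆ ∣                            ≡⟨ cong ∣_∣ X≡ ⟨
          ∣ X ∣                                     ∎
          where
          active≡ : X ∩ active X ≡ (X′ ∩ active X′) ∪ ⁅ m ⁆
          active≡ = ⊆-antisym ⊆insert (insert⊆ ⊇active
            (x∈p∩q⁺ (m∈X , active⁺ (X⊆E m∈X) (subst (m ∈cl_) (sym above-m) m∈cl))))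
            where
            ⊆insert : X ∩ active X ⊆ (X′ ∩ active X′) ∪ ⁅ m ⁆
            ⊆insert {x} x∈ with x ≟ m
            ... | yes refl = ∈-insert (X′ ∩ active X′) m
            ... | no  x≢m  = p⊆p∪q ⁅ m ⁆ (⊆active x∈ x≢m)
        ... | no m∉cl = begin
          rank N X + ∣ X ∩ active X ∣               ≡⟨ cong₂ (λ S T → rank N S + ∣ T ∣) X≡ active≡ ⟩
          rank N (X′ ∪ ⁅ m ⁆) + ∣ X′ ∩ active X′ ∣  ≡⟨ cong (_+ ∣ X′ ∩ active X′ ∣) (∉cl⇒rank-insert m∉cl) ⟩
          suc (rank N X′ + ∣ X′ ∩ active X′ ∣)      ≡⟨ cong suc IH ⟩
          suc ∣ X′ ∣                                ≡⟨ ∣insert∣ X′ m∉X′ ⟨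
          ∣ X′ ∪ ⁅ m ⁆ ∣                            ≡⟨ cong ∣_∣ X≡ ⟨
          ∣ X ∣                                     ∎
          where
          active≡ : X ∩ active X ≡ X′ ∩ active X′
          active≡ = ⊆-antisym
            (λ x∈ → ⊆active x∈ λ { refl →
              m∉cl (subst (m ∈cl_) above-m (proj₂ (active⁻ (p∩q⊆q X (active X) x∈)))) })
            ⊇active

    -- By `rank+∣active∣`, rank and size of `X` agree exactly when `X ∩ active X` is empty. This
    -- serves for independence in `M` and, on complements in `M′ ⋆`, for spanning in `M′`.
    rank≡∣∣⇒active∉ : X ⊆ E → rank N X ≡ ∣ X ∣ → e ∈ active X → e ∉ X
    rank≡∣∣⇒active∉ {X} {e} X⊆E eq e∈a e∈X = contradiction
      (ℕ.+-cancelˡ-≡ ∣ X ∣ _ 0 (trans (trans (cong (_+ ∣ X ∩ active X ∣) (sym eq)) (rank+∣active∣ X⊆E))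
        (sym (ℕ.+-identityʳ ∣ X ∣))))
      (ℕ.>⇒≢ (ℕ.≤-trans (ℕ.≤-reflexive (sym (∣⁅x⁆∣≡1 e))) (p⊆q⇒∣p∣≤∣q∣ (⁅⁆⊆ (x∈p∩q⁺ (e∈X , e∈a))))))

    active∉⇒rank≡∣∣ : X ⊆ E → (∀ {e} → e ∈ active X → e ∉ X) → rank N X ≡ ∣ X ∣
    active∉⇒rank≡∣∣ {X} X⊆E avoid = begin
      rank N X                     ≡⟨ ℕ.+-identityʳ _ ⟨
      rank N X + 0                 ≡⟨ cong (rank N X +_) (Empty⇒∣p∣≡0 empty) ⟨
      rank N X + ∣ X ∩ active X ∣  ≡⟨ rank+∣active∣ X⊆E ⟩
      ∣ X ∣                        ∎
      where
      open ≡-Reasoning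
      empty : Empty (X ∩ active X)
      empty (x , x∈) = let x∈X , x∈a = x∈p∩q⁻ X (active X) x∈ in avoid x∈a x∈X

    -- Both sides are the nullity of `X`, by `rank-dual-restriction` and `rank+∣active∣`.
    r-dual-restriction : X ⊆ E → active X ⊆ X → r ((N ↾ X) ⋆) ≡ ∣ active X ∣
    r-dual-restriction {X} X⊆E a⊆X = ℕ.+-cancelʳ-≡ (rank N X) _ _ (begin
      r ((N ↾ X) ⋆) + rank N X       ≡⟨ rank-dual-restriction N X ⟩
      ∣ X ∣                          ≡⟨ rank+∣active∣ X⊆E ⟨
      rank N X + ∣ X ∩ active X ∣    ≡⟨ cong (λ S → rank N X + ∣ S ∣) (q⊆p⇒p∩q≡q a⊆X) ⟩
      rank N X + ∣ active X ∣        ≡⟨ ℕ.+-comm (rank N X) _ ⟩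
      ∣ active X ∣ + rank N X        ∎)
      where open ≡-Reasoning

-- The involution that toggles active elements.

∉⇒lookup : ∀ (X : Subset n) → g ∉ X → lookup X g ≡ outside
∉⇒lookup X g∉ = Bool.¬-not (g∉ ∘ Vec.lookup⇒[]= _ X)

module Toggle {n ℓ} {_<_ : Rel (Fin n) ℓ} (<-sto : IsStrictTotalOrder _≡_ _<_) {E : Subset n} where
  open Order <-sto
  open IsStrictTotalOrder <-sto using (compare; irrefl) renaming (trans to <-trans)
  open Active using (active; active⁺; active⁻; active⊆; active-local)

  -- `Dual.orthogonal` gives this for `N` and `N ⋆`. An arbitrary pair is allowed so that `M` and
  -- `M′ ⋆` are covered and the two roles can be exchanged.
  Orthogonal : Matroid E → Matroid E → Set
  Orthogonal N N′ = ∀ {e A A′} → e ∈ E → A ⊆ E → A′ ⊆ E → e ∉ A → e ∉ A′ →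
    (∀ {x} → x ∈ A → x ∉ A′) → Closure._∈cl_ N e A → ¬ Closure._∈cl_ N′ e A′

  Orthogonal-sym : ∀ {N N′} → Orthogonal N N′ → Orthogonal N′ N
  Orthogonal-sym orth e∈E A⊆E A′⊆E e∉A e∉A′ A#A′ e∈clA e∈clA′ =
    orth e∈E A′⊆E A⊆E e∉A′ e∉A (λ x∈A′ x∈A → A#A′ x∈A x∈A′) e∈clA′ e∈clA

  AgreeOff : Fin n → Subset n → Subset n → Set
  AgreeOff f X Y = ∀ g → g ≢ f → lookup X g ≡ lookup Y g

  lookup-─ : ∀ (X Y : Subset n) g → lookup X g ≡ lookup Y g → lookup (E ─ X) g ≡ lookup (E ─ Y) g
  lookup-─ X Y g eq with g ∈? (E ─ X) | g ∈? (E ─ Y)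
  ... | yes g∈  | yes g∈′ = trans (Vec.[]=⇒lookup g∈) (sym (Vec.[]=⇒lookup g∈′))
  ... | yes g∈  | no  g∉′ = contradiction
    (x∈p∧x∉q⇒x∈p─q (p─q⊆p E X g∈) (x∈p─q⇒x∉q E X g∈ ∘ ∈-lookup (sym eq))) g∉′
  ... | no  g∉  | yes g∈′ = contradiction
    (x∈p∧x∉q⇒x∈p─q (p─q⊆p E Y g∈′) (x∈p─q⇒x∉q E Y g∈′ ∘ ∈-lookup eq)) g∉
  ... | no  g∉  | no  g∉′ = trans (∉⇒lookup _ g∉) (sym (∉⇒lookup _ g∉′))

  module _ (N N′ : Matroid E) (orth : Orthogonal N N′) where
    open Closure N

    -- If f is active in N, it lies in the closure of what is above it; if f is
    -- active in N′, then by exchange f would lie in the N-closure of a set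
    -- that is disjoint from one whose N′-closure contains f.
    active-AgreeOff⊆ : X ⊆ E → Y ⊆ E → AgreeOff f X Y →
                       f ∈ active N X ⊎ f ∈ active N′ (E ─ X) → active N X ⊆ active N Y
    active-AgreeOff⊆ {X} {Y} {f} X⊆E Y⊆E agree f-active {e} e∈ with compare e f
    -- Unless `e < f`, the sets `X` and `Y` agree above `e`.
    ... | tri≈ _ refl _ = active-local N (∩above-cong λ e<g → agree _ λ { refl → irrefl refl e<g }) e∈
    ... | tri> _ _ f<e  = active-local N (∩above-cong λ e<g → agree _ λ { refl → irrefl refl (<-trans f<e e<g) }) e∈
    ... | tri< e<f _ _ with e∈E , e∈cl ← active⁻ N e∈ = active⁺ N e∈E (absorb f-active)
      where
      Xₑ = X ∩ above e
      Yₑ = Y ∩ above e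

      Xₑ⊆Yₑ∪f : Xₑ ⊆ Yₑ ∪ ⁅ f ⁆
      Xₑ⊆Yₑ∪f {g} g∈ with g∈X , e<g ← ∈-∩above⁻ g∈ with g ≟ f
      ... | yes refl = ∈-insert Yₑ f
      ... | no  g≢f  = p⊆p∪q ⁅ f ⁆ (x∈p∩q⁺ (∈-lookup (agree g g≢f) g∈X , ∈-above⁺ e<g))

      e∈clYₑ∪f : e ∈cl Yₑ ∪ ⁅ f ⁆
      e∈clYₑ∪f = cl-mono Xₑ⊆Yₑ∪f e∈cl

      same-above : X ∩ above f ≡ Y ∩ above f
      same-above = ∩above-cong λ f<g → agree _ λ { refl → irrefl refl f<g }

      same-above′ : (E ─ X) ∩ above f ≡ (E ─ Y) ∩ above f
      same-above′ = ∩above-cong λ {g} f<g → lookup-─ X Y g (agree g λ { refl → irrefl refl f<g })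

      absorb : f ∈ active N X ⊎ f ∈ active N′ (E ─ X) → e ∈cl Yₑ
      absorb (inj₁ f∈) = cl-absorb (cl-mono ⊆Yₑ (subst (f ∈cl_) same-above (proj₂ (active⁻ N f∈)))) e∈clYₑ∪f
        where
        ⊆Yₑ : Y ∩ above f ⊆ Yₑ
        ⊆Yₑ g∈ = let g∈Y , f<g = ∈-∩above⁻ g∈ in x∈p∩q⁺ (g∈Y , ∈-above⁺ (<-trans e<f f<g))
      absorb (inj₂ f∈′) with f ∈? Yₑ
      ... | yes f∈Yₑ = cl-mono (insert⊆ id f∈Yₑ) e∈clYₑ∪f
      -- The set `Yₑ ∪ ⁅ e ⁆` misses `(E ─ Y) ∩ above f`: `Yₑ` lies in `Y`, and `e` is below `f`.
      ... | no  f∉Yₑ = decidable-stable (e ∈cl? Yₑ) λ e∉clYₑ →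
        orth (active⊆ N′ f∈′) (insert⊆ (Y⊆E ∘ p∩q⊆p Y (above e)) e∈E)
          (p─q⊆p E Y ∘ p∩q⊆p (E ─ Y) (above f))
          ([ f∉Yₑ , (λ { refl → irrefl refl e<f }) ]′ ∘ ∈-insert⁻ Yₑ)
          (λ f∈ → irrefl refl (proj₂ (∈-∩above⁻ f∈)))
          (λ x∈ x∈′ → let x∈E─Y , f<x = ∈-∩above⁻ x∈′ in
            [ (λ x∈Yₑ → x∈p─q⇒x∉q E Y x∈E─Y (p∩q⊆p Y (above e) x∈Yₑ))
            , (λ { refl → irrefl refl (<-trans e<f f<x) }) ]′ (∈-insert⁻ Yₑ x∈))
          (exchange e∈clYₑ∪f e∉clYₑ)
          (subst (Closure._∈cl_ N′ f) same-above′ (proj₂ (active⁻ N′ f∈′)))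

    -- The activity of `f` depends only on elements above `f`, where `X` and `Y` agree. So `f` is
    -- active for `Y` as well, and the inclusion can be used in both directions.
    active-AgreeOff : X ⊆ E → Y ⊆ E → AgreeOff f X Y →
                      f ∈ active N X ⊎ f ∈ active N′ (E ─ X) → active N X ≡ active N Y
    active-AgreeOff {X} {Y} {f} X⊆E Y⊆E agree f-active =
      ⊆-antisym (active-AgreeOff⊆ X⊆E Y⊆E agree f-active)
        (active-AgreeOff⊆ Y⊆E X⊆E (λ g → sym ∘ agree g) (Sum.map
          (active-local N (∩above-cong λ f<g → agree _ (above≢ f<g)))
          (active-local N′ (∩above-cong λ {g} f<g → lookup-─ X Y g (agree g (above≢ f<g)))) f-active))
      where
      above≢ : ∀ {g} → f < g → g ≢ f
      above≢ f<g refl = irrefl refl f<g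

  -- For N = M and N′ = M′ ⋆, a B and a′ B are the external and internal
  -- activities, Avoiding are the sets that are independent in M and spanning
  -- in M′, and Absorbing is 𝒟.
  module _ (N N′ : Matroid E) (orth : Orthogonal N N′) where

    a a′ act : Subset n → Subset n
    a X  = active N X
    a′ X = active N′ (E ─ X)
    act X = a X ∪ a′ X

    act⊆E : act X ⊆ E
    act⊆E = ∪-lub (active⊆ N) (active⊆ N′)

    -- X is turned into Y one element at a time; L covers where they may differ.
    active-invariant : ∀ L → X ⊆ E → Y ⊆ E →
      (∀ g → lookup X g ≡ lookup Y g ⊎ (g ∈ₗ L × g ∈ act X)) → a X ≡ a Y × a′ X ≡ a′ Y
    active-invariant {X} {Y} [] X⊆E Y⊆E agree
      with refl ← lookup-ext X Y (λ g → [ id , (λ ()) ]′ (agree g)) = refl , refl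
    active-invariant {X} {Y} (f ∷ L) X⊆E Y⊆E agree with agree f
    ... | inj₁ eq = active-invariant L X⊆E Y⊆E λ g → shrink g (agree g)
      where
      shrink : ∀ g → lookup X g ≡ lookup Y g ⊎ (g ∈ₗ f ∷ L × g ∈ act X) →
               lookup X g ≡ lookup Y g ⊎ (g ∈ₗ L × g ∈ act X)
      shrink g (inj₁ eq′)                = inj₁ eq′
      shrink g (inj₂ (here refl , _))    = inj₁ eq
      shrink g (inj₂ (there g∈L , g∈act)) = inj₂ (g∈L , g∈act)
    ... | inj₂ (_ , f∈act) = trans aX≡aZ (proj₁ rest) , trans a′X≡a′Z (proj₂ rest)
      where
      Z = X [ f ]≔ lookup Y f

      agreeXZ : AgreeOff f X Z
      agreeXZ g g≢f = sym (Vec.lookup∘update′ g≢f X (lookup Y f))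

      Z⊆E : Z ⊆ E
      Z⊆E {g} g∈ with g ≟ f
      ... | yes refl = act⊆E f∈act
      ... | no  g≢f  = X⊆E (∈-lookup (sym (agreeXZ g g≢f)) g∈)

      f-active : f ∈ a X ⊎ f ∈ a′ X
      f-active = x∈p∪q⁻ (a X) (a′ X) f∈act

      aX≡aZ : a X ≡ a Z
      aX≡aZ = active-AgreeOff N N′ orth X⊆E Z⊆E agreeXZ f-active

      a′X≡a′Z : a′ X ≡ a′ Z
      -- Here the complements are compared with `N` and `N′` exchanged, so activity in `N` is taken
      -- at `E ─ (E ─ X)`, which is `X`.
      a′X≡a′Z = active-AgreeOff N′ N (Orthogonal-sym {N} {N′} orth) (p─q⊆p E X) (p─q⊆p E Z)
        (λ g g≢f → lookup-─ X Z g (agreeXZ g g≢f))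
        (Sum.swap (Sum.map₁ (subst (λ S → f ∈ active N S) (sym (p─[p─q]≡q X⊆E))) f-active))

      agreeZY : ∀ g → lookup Z g ≡ lookup Y g ⊎ (g ∈ₗ L × g ∈ act Z)
      agreeZY g with g ≟ f
      ... | yes refl = inj₁ (Vec.lookup∘update f X (lookup Y f))
      ... | no  g≢f with agree g
      ... | inj₁ eq                   = inj₁ (trans (sym (agreeXZ g g≢f)) eq)
      ... | inj₂ (here g≡f , _)       = contradiction g≡f g≢f
      -- The elements still to be changed remain active, because `act Z` equals `act X`.
      ... | inj₂ (there g∈L , g∈act) = inj₂ (g∈L , subst (g ∈_) (cong₂ _∪_ aX≡aZ a′X≡a′Z) g∈act)

      rest : a Z ≡ a Y × a′ Z ≡ a′ Y
      rest = active-invariant L Z⊆E Y⊆E agreeZY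

    toggle : Subset n → Subset n
    toggle X = zipWith _xor_ X (act X)

    lookup-toggle : ∀ X g → lookup (toggle X) g ≡ lookup X g xor lookup (act X) g
    lookup-toggle X g = Vec.lookup-zipWith _xor_ g X (act X)

    ∉act⇒lookup-toggle : g ∉ act X → lookup (toggle X) g ≡ lookup X g
    ∉act⇒lookup-toggle {g} {X} g∉ = trans (lookup-toggle X g)
      (trans (cong (lookup X g xor_) (∉⇒lookup _ g∉)) (Bool.xor-identityʳ _))

    ∈act∧∈⇒∉toggle : g ∈ act X → g ∈ X → g ∉ toggle X
    ∈act∧∈⇒∉toggle {g} {X} g∈act g∈X g∈
      with () ← trans (sym (Vec.[]=⇒lookup g∈)) (trans (lookup-toggle X g)
                  (cong₂ _xor_ (Vec.[]=⇒lookup g∈X) (Vec.[]=⇒lookup g∈act)))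

    ∈act∧∉⇒∈toggle : g ∈ act X → g ∉ X → g ∈ toggle X
    ∈act∧∉⇒∈toggle {g} {X} g∈act g∉X = Vec.lookup⇒[]= g (toggle X) (trans (lookup-toggle X g)
      (cong₂ _xor_ (∉⇒lookup _ g∉X) (Vec.[]=⇒lookup g∈act)))

    toggle⊆E : X ⊆ E → toggle X ⊆ E
    toggle⊆E {X} X⊆E {g} g∈ with g ∈? act X
    ... | yes g∈act = act⊆E g∈act
    ... | no  g∉act = X⊆E (∈-lookup (∉act⇒lookup-toggle g∉act) g∈)

    active-toggle : X ⊆ E → a X ≡ a (toggle X) × a′ X ≡ a′ (toggle X)
    active-toggle {X} X⊆E = active-invariant (allFin n) X⊆E (toggle⊆E X⊆E) agree
      where
      agree : ∀ g → lookup X g ≡ lookup (toggle X) g ⊎ (g ∈ₗ allFin n × g ∈ act X)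
      agree g with g ∈? act X
      ... | yes g∈act = inj₂ (Membership.∈-allFin g , g∈act)
      ... | no  g∉act = inj₁ (sym (∉act⇒lookup-toggle g∉act))

    -- By `active-toggle`, the second application flips the same elements as the first.
    toggle-involutive : X ⊆ E → toggle (toggle X) ≡ X
    toggle-involutive {X} X⊆E = lookup-ext _ X λ g → begin
      lookup (toggle (toggle X)) g                                ≡⟨ lookup-toggle (toggle X) g ⟩
      lookup (toggle X) g xor lookup (act (toggle X)) g           ≡⟨ cong₂ (λ b S → b xor lookup S g) (lookup-toggle X g)
                                                                       (sym (cong₂ _∪_ (proj₁ (active-toggle X⊆E)) (proj₂ (active-toggle X⊆E)))) ⟩
      (lookup X g xor lookup (act X) g) xor lookup (act X) g      ≡⟨ Bool.xor-assoc (lookup X g) _ _ ⟩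
      lookup X g xor (lookup (act X) g xor lookup (act X) g)      ≡⟨ cong (lookup X g xor_) (Bool.xor-same (lookup (act X) g)) ⟩
      lookup X g xor false                                        ≡⟨ Bool.xor-identityʳ _ ⟩
      lookup X g                                                  ∎
      where open ≡-Reasoning

    Avoiding Absorbing : Pred (Subset n) _
    Avoiding  X = X ⊆ E × (∀ {g} → g ∈ a X → g ∉ X) × (∀ {g} → g ∈ a′ X → g ∈ X)
    Absorbing X = X ⊆ E × (∀ {g} → g ∈ a X → g ∈ X) × (∀ {g} → g ∈ a′ X → g ∉ X)

    toggle-Avoiding : Avoiding X → Absorbing (toggle X)
    toggle-Avoiding {X} (X⊆E , a∉ , a′∈) with a≡ , a′≡ ← active-toggle X⊆E =
      toggle⊆E X⊆E
      , (λ g∈ → let g∈ = subst (_ ∈_) (sym a≡) g∈ in ∈act∧∉⇒∈toggle (p⊆p∪q (a′ X) g∈) (a∉ g∈))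
      , (λ g∈ → let g∈ = subst (_ ∈_) (sym a′≡) g∈ in ∈act∧∈⇒∉toggle (q⊆p∪q (a X) (a′ X) g∈) (a′∈ g∈))

    toggle-Absorbing : Absorbing X → Avoiding (toggle X)
    toggle-Absorbing {X} (X⊆E , a∈ , a′∉) with a≡ , a′≡ ← active-toggle X⊆E =
      toggle⊆E X⊆E
      , (λ g∈ → let g∈ = subst (_ ∈_) (sym a≡) g∈ in ∈act∧∈⇒∉toggle (p⊆p∪q (a′ X) g∈) (a∈ g∈))
      , (λ g∈ → let g∈ = subst (_ ∈_) (sym a′≡) g∈ in ∈act∧∉⇒∈toggle (q⊆p∪q (a X) (a′ X) g∈) (a′∉ g∈))

    -- For avoiding `X`, toggling adds `a X` and removes `a′ X`. Both sides count the set `X ∪ a X`,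
    -- which equals `toggle X ∪ a′ X`, as a disjoint union.
    ∣toggle∣ : Avoiding X → ∣ toggle X ∣ + ∣ a′ X ∣ ≡ ∣ X ∣ + ∣ a X ∣
    ∣toggle∣ {X} av@(X⊆E , a∉ , a′∈) = begin
      ∣ toggle X ∣ + ∣ a′ X ∣  ≡⟨ disjoint⇒∣p∪q∣≡∣p∣+∣q∣ (toggle X) (a′ X) (λ g∈ g∈a′ →
                                    ∈act∧∈⇒∉toggle (q⊆p∪q (a X) (a′ X) g∈a′) (a′∈ g∈a′) g∈) ⟨
      ∣ toggle X ∪ a′ X ∣        ≡⟨ cong ∣_∣ (⊆-antisym
                                    (∪-lub toggle⊆ (p⊆p∪q (a X) ∘ a′∈))
                                    (∪-lub X⊆ (p⊆p∪q (a′ X) ∘ λ g∈ → ∈act∧∉⇒∈toggle (p⊆p∪q (a′ X) g∈) (a∉ g∈)))) ⟩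
      ∣ X ∪ a X ∣                ≡⟨ disjoint⇒∣p∪q∣≡∣p∣+∣q∣ X (a X) (λ g∈X g∈a → a∉ g∈a g∈X) ⟩
      ∣ X ∣ + ∣ a X ∣          ∎
      where
      open ≡-Reasoning
      toggle⊆ : toggle X ⊆ X ∪ a X
      toggle⊆ {g} g∈ with g ∈? act X
      ... | no  g∉act = p⊆p∪q (a X) (∈-lookup (∉act⇒lookup-toggle g∉act) g∈)
      ... | yes g∈act with x∈p∪q⁻ (a X) (a′ X) g∈act
      ... | inj₁ g∈a  = q⊆p∪q X (a X) g∈a
      ... | inj₂ g∈a′ = p⊆p∪q (a X) (a′∈ g∈a′)

      X⊆ : X ⊆ toggle X ∪ a′ X
      X⊆ {g} g∈ with g ∈? act X
      ... | no  g∉act = p⊆p∪q (a′ X) (∈-lookup (sym (∉act⇒lookup-toggle g∉act)) g∈)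
      ... | yes g∈act with x∈p∪q⁻ (a X) (a′ X) g∈act
      ... | inj₁ g∈a  = contradiction g∈ (a∉ g∈a)
      ... | inj₂ g∈a′ = q⊆p∪q (toggle X) (a′ X) g∈a′

-- The two families of sets and the exponents.

module Classes {n ℓ} {_<_ : Rel (Fin n) ℓ} (<-sto : IsStrictTotalOrder _≡_ _<_)
  {E : Subset n} (M M′ : Matroid E) (persp : Perspective M M′) where
  open Order <-sto
  open Active using (active; active⊆; circuit⇒active; active⇒circuit; compatible⇒; compatible⇐;
    rank≡∣∣⇒active∉; active∉⇒rank≡∣∣; rank+∣active∣; r-dual-restriction)
  open Toggle <-sto {E}

  -- The perspective carries `e` from the `M`-closure to the `M′`-closure of `A`, and there duality
  -- applies.
  orth : Orthogonal M (M′ ⋆)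
  orth e∈E A⊆E A′⊆E e∉A e∉A′ A#A′ =
    Dual.orthogonal M′ e∈E A⊆E A′⊆E e∉A e∉A′ A#A′ ∘ perspective⇒cl⊆ M M′ persp e∈E

  τ : Subset n → Subset n
  τ = toggle M (M′ ⋆) orth

  ∈E∧∉E─⇒∈ : ∀ {g X} → g ∈ E → g ∉ E ─ X → g ∈ X
  ∈E∧∉E─⇒∈ {g} {X} g∈E g∉ with g ∈? X
  ... | yes g∈X = g∈X
  ... | no  g∉X = contradiction (x∈p∧x∉q⇒x∈p─q g∈E g∉X) g∉

  dual-rank′ : ∀ {X} → X ⊆ E → rank (M′ ⋆) (E ─ X) + r M′ ≡ ∣ E ─ X ∣ + rank M′ X
  dual-rank′ {X} X⊆E = trans (Dual.dual-rank M′ (p─q⊆p E X))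
    (cong (λ S → ∣ E ─ X ∣ + rank M′ S) (p─[p─q]≡q X⊆E))

  -- Independence of `B` in `M` means that rank and size agree. By the dual rank formula, spanning
  -- in `M′` means the same for `E ─ B` in `M′ ⋆`.
  indep∧spanning⇒avoiding : ∀ {B} → Indep M B × Spanning M′ B → Avoiding M (M′ ⋆) orth B
  indep∧spanning⇒avoiding {B} (iB , B⊆E , spans) = B⊆E
    , rank≡∣∣⇒active∉ M B⊆E (Closure.indep⇒rank≡∣∣ M iB)
    , λ g∈ → ∈E∧∉E─⇒∈ (active⊆ (M′ ⋆) g∈)
        (rank≡∣∣⇒active∉ (M′ ⋆) (p─q⊆p E B)
          (ℕ.+-cancelʳ-≡ (r M′) _ _ (trans (dual-rank′ B⊆E) (cong (∣ E ─ B ∣ +_) spans))) g∈)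

  avoiding⇒indep∧spanning : ∀ {B} → Avoiding M (M′ ⋆) orth B → Indep M B × Spanning M′ B
  avoiding⇒indep∧spanning {B} (B⊆E , a∉ , a′∈) =
    Closure.rank≡∣∣⇒indep M (active∉⇒rank≡∣∣ M B⊆E a∉) , B⊆E ,
    ℕ.+-cancelˡ-≡ ∣ E ─ B ∣ _ _ (trans (sym (dual-rank′ B⊆E))
      (cong (_+ r M′) (active∉⇒rank≡∣∣ (M′ ⋆) (p─q⊆p E B) λ g∈ g∉B → x∈p─q⇒x∉q E B g∉B (a′∈ g∈))))

  𝒟⇒absorbing : ∀ {X} → 𝒟 <-sto M M′ X → Absorbing M (M′ ⋆) orth X
  𝒟⇒absorbing {X} (X⊆E , comp′ , comp) = X⊆E
    , (λ g∈ → ∈E∧∉E─⇒∈ (active⊆ M g∈)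
        (compatible⇒ M comp (subst (λ S → _ ∈ active M S) (sym (p─[p─q]≡q X⊆E)) g∈)))
    , compatible⇒ (M′ ⋆) comp′

  absorbing⇒𝒟 : ∀ {X} → Absorbing M (M′ ⋆) orth X → 𝒟 <-sto M M′ X
  absorbing⇒𝒟 {X} (X⊆E , a∈ , a′∉) = X⊆E
    , compatible⇐ (M′ ⋆) X⊆E a′∉
    , compatible⇐ M (p─q⊆p E X) λ g∈ g∈E─X → x∈p─q⇒x∉q E X g∈E─X
        (a∈ (subst (λ S → _ ∈ active M S) (p─[p─q]≡q X⊆E) g∈))

  module _ {B : Subset n} (avoiding : Avoiding M (M′ ⋆) orth B) where
    private
      B⊆E = proj₁ avoiding
      a∉  = proj₁ (proj₂ avoiding)
      a′∈ = proj₂ (proj₂ avoiding)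
      τB = τ B
      absorbing = toggle-Avoiding M (M′ ⋆) orth avoiding
      τB⊆E = proj₁ absorbing
      a⊆τB = proj₁ (proj₂ absorbing)
      a′∉τB = proj₂ (proj₂ absorbing)
      a≡ = proj₁ (active-toggle M (M′ ⋆) orth B⊆E)
      a′≡ = proj₂ (active-toggle M (M′ ⋆) orth B⊆E)
      ext int : Subset n
      ext = active M B
      int = active (M′ ⋆) (E ─ B)

      int⊆E─τB : active (M′ ⋆) (E ─ τB) ⊆ E ─ τB
      int⊆E─τB g∈ = x∈p∧x∉q⇒x∈p─q (active⊆ (M′ ⋆) g∈) (a′∉τB g∈)

    -- `Int` also asks for membership in `B`, which every element of `int` has because `B` is
    -- avoiding. `Ext≡` is analogous, with membership in `E ─ B`.
    Int≡ : Int <-sto M′ B ≡ int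
    Int≡ = ⊆-antisym
      (λ g∈ → circuit⇒active (M′ ⋆) (proj₂ (∈-separate⁻ int? g∈)))
      (λ g∈ → ∈-separate⁺ int? (a′∈ g∈ , active⇒circuit (M′ ⋆) g∈))
      where
      int? : Decidable λ e → e ∈ B × ContainsCircuitWithMin <-sto (M′ ⋆) ((E ─ B) ∪ ⁅ e ⁆) e
      int? e = e ∈? B ×-dec containsCircuitWithMin? <-sto (M′ ⋆) ((E ─ B) ∪ ⁅ e ⁆) e

    Ext≡ : Ext <-sto M B ≡ ext
    Ext≡ = ⊆-antisym
      (λ g∈ → circuit⇒active M (proj₂ (∈-separate⁻ ext? g∈)))
      (λ g∈ → ∈-separate⁺ ext? (x∈p∧x∉q⇒x∈p─q (active⊆ M g∈) (a∉ g∈) , active⇒circuit M g∈))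
      where
      ext? : Decidable λ e → e ∈ E ─ B × ContainsCircuitWithMin <-sto M (B ∪ ⁅ e ⁆) e
      ext? e = e ∈? (E ─ B) ×-dec containsCircuitWithMin? <-sto M (B ∪ ⁅ e ⁆) e

    ∣Int∣≡ : ∣ Int <-sto M′ B ∣ ≡ r (M′ / τ B)
    ∣Int∣≡ = begin
      ∣ Int <-sto M′ B ∣           ≡⟨ cong ∣_∣ (trans Int≡ a′≡) ⟩
      -- By definition `M′ / τB` is `(M′ ⋆ ↾ (E ─ τB)) ⋆`.
      ∣ active (M′ ⋆) (E ─ τB) ∣    ≡⟨ r-dual-restriction (M′ ⋆) (p─q⊆p E τB) int⊆E─τB ⟨
      r (M′ / τB)                   ∎
      where open ≡-Reasoning

    ∣Ext∣≡ : ∣ Ext <-sto M B ∣ ≡ r ((M ↾ τ B) ⋆)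
    ∣Ext∣≡ = begin
      ∣ Ext <-sto M B ∣    ≡⟨ cong ∣_∣ (trans Ext≡ a≡) ⟩
      ∣ active M τB ∣       ≡⟨ r-dual-restriction M τB⊆E a⊆τB ⟨
      r ((M ↾ τB) ⋆)        ∎
      where open ≡-Reasoning

    -- `τ B` contains its active elements, so its rank is its size less `∣ ext ∣`, whereas `B` has
    -- full rank in `M`. `∣toggle∣` compares the two sizes.
    rank-τ : rank M (τ B) + ∣ int ∣ ≡ rank M B
    rank-τ = ℕ.+-cancelʳ-≡ ∣ ext ∣ _ _ (begin
      (rank M τB + ∣ int ∣) + ∣ ext ∣            ≡⟨ ℕ.+-assoc (rank M τB) _ _ ⟩
      rank M τB + (∣ int ∣ + ∣ ext ∣)            ≡⟨ cong (rank M τB +_) (ℕ.+-comm ∣ int ∣ _) ⟩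
      rank M τB + (∣ ext ∣ + ∣ int ∣)            ≡⟨ ℕ.+-assoc (rank M τB) _ _ ⟨
      (rank M τB + ∣ ext ∣) + ∣ int ∣            ≡⟨ cong (λ S → (rank M τB + ∣ S ∣) + ∣ int ∣) (trans a≡ (sym (q⊆p⇒p∩q≡q a⊆τB))) ⟩
      (rank M τB + ∣ τB ∩ active M τB ∣) + ∣ int ∣ ≡⟨ cong (_+ ∣ int ∣) (rank+∣active∣ M τB⊆E) ⟩
      ∣ τB ∣ + ∣ int ∣                             ≡⟨ ∣toggle∣ M (M′ ⋆) orth avoiding ⟩
      ∣ B ∣ + ∣ ext ∣                             ≡⟨ cong (_+ ∣ ext ∣) (active∉⇒rank≡∣∣ M B⊆E a∉) ⟨
      rank M B + ∣ ext ∣                          ∎)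
      where open ≡-Reasoning

    -- `E ─ τB` has nullity `∣ int ∣` in `M′ ⋆`; the dual rank formula turns this into the distance
    -- of `rank M′ (τ B)` from `r M′`, which is `rank M′ B` because `B` spans.
    rank′-τ : rank M′ (τ B) + ∣ int ∣ ≡ rank M′ B
    rank′-τ = ℕ.+-cancelˡ-≡ (rank (M′ ⋆) (E ─ τB)) _ _ (begin
      r⋆ + (rank M′ τB + ∣ int ∣)   ≡⟨ cong (r⋆ +_) (ℕ.+-comm (rank M′ τB) _) ⟩
      r⋆ + (∣ int ∣ + rank M′ τB)   ≡⟨ ℕ.+-assoc r⋆ _ _ ⟨
      (r⋆ + ∣ int ∣) + rank M′ τB   ≡⟨ cong (λ S → (r⋆ + ∣ S ∣) + rank M′ τB) (trans a′≡ (sym (q⊆p⇒p∩q≡q int⊆E─τB))) ⟩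
      (r⋆ + ∣ (E ─ τB) ∩ active (M′ ⋆) (E ─ τB) ∣) + rank M′ τB
                                       ≡⟨ cong (_+ rank M′ τB) (rank+∣active∣ (M′ ⋆) (p─q⊆p E τB)) ⟩
      ∣ E ─ τB ∣ + rank M′ τB          ≡⟨ dual-rank′ τB⊆E ⟨
      r⋆ + r M′                      ≡⟨ cong (r⋆ +_) (proj₂ (proj₂ (avoiding⇒indep∧spanning avoiding))) ⟨
      r⋆ + rank M′ B                 ∎)
      where
      open ≡-Reasoning
      r⋆ = rank (M′ ⋆) (E ─ τB)

    -- Passing from `B` to `τ B` lowers both ranks by `∣ int ∣`, which cancels even in truncated
    -- subtraction.
    rank-difference-τ : rank M B ∸ rank M′ B ≡ rank M (τ B) ∸ rank M′ (τ B)
    rank-difference-τ = begin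
      rank M B ∸ rank M′ B                                ≡⟨ cong₂ _∸_ rank-τ rank′-τ ⟨
      (rank M τB + ∣ int ∣) ∸ (rank M′ τB + ∣ int ∣)    ≡⟨ cong₂ _∸_ (ℕ.+-comm (rank M τB) _) (ℕ.+-comm (rank M′ τB) _) ⟩
      (∣ int ∣ + rank M τB) ∸ (∣ int ∣ + rank M′ τB)    ≡⟨ ℕ.[m+n]∸[m+o]≡n∸o ∣ int ∣ (rank M τB) _ ⟩
      rank M τB ∸ rank M′ τB                                ∎
      where open ≡-Reasoning

-- Reindexing sums over families of subsets.

-- Injectivity is required only on the list, because `τ` is known to be an involution only on the
-- sets summed over.
map-unique : ∀ {a b} {A : Set a} {B : Set b} (f : A → B) {xs} →
             (∀ {x y} → x ∈ₗ xs → y ∈ₗ xs → f x ≡ f y → x ≡ y) → Unique xs → Unique (List.map f xs)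
map-unique f inj []        = []
map-unique f inj (x∉ ∷ xs) =
  All.map⁺ (All.tabulate λ y∈ eq → All.lookup x∉ y∈ (inj (here refl) (there y∈) eq)) ∷
  map-unique f (λ x∈ y∈ → inj (there x∈) (there y∈)) xs

subsets-unique : ∀ n → Unique (subsets n)
subsets-unique zero    = All.[] ∷ []
subsets-unique (suc n) = Unique.++⁺ (Unique.map⁺ Vec.∷-injectiveʳ (subsets-unique n))
  (Unique.map⁺ Vec.∷-injectiveʳ (subsets-unique n)) disjoint
  where
  disjoint : ∀ {X} → ¬ (X ∈ₗ List.map (outside ∷_) (subsets n) × X ∈ₗ List.map (inside ∷_) (subsets n))
  disjoint (X∈₁ , X∈₂)
    with _ , _ , refl ← Membership.∈-map⁻ (outside ∷_) X∈₁
    with _ , _ , () ← Membership.∈-map⁻ (inside ∷_) X∈₂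

module Reindexing {c ℓ′} (R : CommutativeRing c ℓ′) where
  open CommutativeRing R using (Carrier; _≈_; 0#; +-cong; +-congˡ; +-congʳ; +-assoc; +-comm)
    renaming (_+_ to _⊕_; refl to ≈-refl; trans to ≈-trans; sym to ≈-sym)
  open Evaluation R using (∑)

  total : (Subset n → Carrier) → List (Subset n) → Carrier
  total f = foldr (λ X s → f X ⊕ s) 0#

  total-↭ : ∀ (f : Subset n → Carrier) {xs ys} → xs ↭ ys → total f xs ≈ total f ys
  total-↭ f ↭.refl         = ≈-refl
  total-↭ f (↭.prep _ p)   = +-congˡ (total-↭ f p)
  total-↭ f (↭.swap x y p) = ≈-trans (≈-sym (+-assoc (f x) (f y) _))
    (≈-trans (+-cong (+-comm (f x) (f y)) (total-↭ f p)) (+-assoc (f y) (f x) _))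
  total-↭ f (↭.trans p q)  = ≈-trans (total-↭ f p) (total-↭ f q)

  total-map : ∀ (f g : Subset n → Carrier) τ xs → (∀ {X} → X ∈ₗ xs → f X ≈ g (τ X)) →
              total f xs ≈ total g (List.map τ xs)
  total-map f g τ []       eq = ≈-refl
  total-map f g τ (X ∷ xs) eq = +-cong (eq (here refl)) (total-map f g τ xs (eq ∘ there))

  ∑-reindex : ∀ {p q} {P : Pred (Subset n) p} {Q : Pred (Subset n) q} (P? : Decidable P) (Q? : Decidable Q)
    (τ : Subset n → Subset n) →
    (∀ {X} → P X → Q (τ X) × τ (τ X) ≡ X) → (∀ {X} → Q X → P (τ X) × τ (τ X) ≡ X) →
    {f g : Subset n → Carrier} → (∀ {X} → P X → f X ≈ g (τ X)) → ∑ P? f ≈ ∑ Q? g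
  ∑-reindex {n} P? Q? τ P⇒Q Q⇒P {f} {g} eq =
    ≈-trans (total-map f g τ (filter P? (subsets n)) (eq ∘ satisfies))
      -- Two lists without repetitions that have the same elements are permutations of each other.
      (total-↭ g (∼bag⇒↭ (unique∧set⇒bag
        (map-unique τ injective (Unique.filter⁺ P? (subsets-unique n)))
        (Unique.filter⁺ Q? (subsets-unique n))
        (mk⇔ to from))))
    where
    satisfies : ∀ {X} → X ∈ₗ filter P? (subsets n) → _
    satisfies X∈ = proj₂ (Membership.∈-filter⁻ P? {xs = subsets n} X∈)

    injective : ∀ {X Y} → X ∈ₗ filter P? (subsets n) → Y ∈ₗ filter P? (subsets n) → τ X ≡ τ Y → X ≡ Y
    injective X∈ Y∈ eq = trans (sym (proj₂ (P⇒Q (satisfies X∈)))) (trans (cong τ eq) (proj₂ (P⇒Q (satisfies Y∈))))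

    to : ∀ {Y} → Y ∈ₗ List.map τ (filter P? (subsets n)) → Y ∈ₗ filter Q? (subsets n)
    to Y∈ with X , X∈ , refl ← Membership.∈-map⁻ τ Y∈ =
      Membership.∈-filter⁺ Q? (∈-subsets (τ X)) (proj₁ (P⇒Q (satisfies X∈)))

    from : ∀ {Y} → Y ∈ₗ filter Q? (subsets n) → Y ∈ₗ List.map τ (filter P? (subsets n))
    from {Y} Y∈ with pτY , ττY≡Y ← Q⇒P (proj₂ (Membership.∈-filter⁻ Q? {xs = subsets n} Y∈)) =
      subst (_∈ₗ _) ττY≡Y (Membership.∈-map⁺ τ (Membership.∈-filter⁺ P? (∈-subsets (τ Y)) pτY))

corollary10 : {n : ℕ} {E : Subset n} (M M′ : Matroid E) → Perspective M M′ →
    {ℓ : Level} {_<_ : Rel (Fin n) ℓ} (<-sto : IsStrictTotalOrder _≡_ _<_) →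
    {c ℓ′ : Level} (R : CommutativeRing c ℓ′) → let open Evaluation R in
    (x y z : Carrier) →
    T <-sto M M′ x y z ≈
    ∑ (𝒟? <-sto M M′) (λ X →
    x ^ r (M′ / X) *
    y ^ r ((M ↾ X) ⋆) *
    z ^ ((r M ∸ r M′) ∸ (rank M X ∸ rank M′ X)))
corollary10 M M′ persp <-sto R x y z =
  ∑-reindex _ (𝒟? <-sto M M′) τ
    (λ PB → let b = indep∧spanning⇒avoiding PB in
      absorbing⇒𝒟 (toggle-Avoiding M (M′ ⋆) orth b) , toggle-involutive M (M′ ⋆) orth (proj₁ b))
    (λ 𝒟X → let d = 𝒟⇒absorbing 𝒟X in
      avoiding⇒indep∧spanning (toggle-Absorbing M (M′ ⋆) orth d) , toggle-involutive M (M′ ⋆) orth (proj₁ d))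
    -- The exponents agree as natural numbers, so corresponding summands are equal in any ring.
    (λ PB → let b = indep∧spanning⇒avoiding PB in reflexive (cong₂ _*_
      (cong₂ (λ i j → x ^ i * y ^ j) (∣Int∣≡ b) (∣Ext∣≡ b))
      (cong (λ d → z ^ ((r M ∸ r M′) ∸ d)) (rank-difference-τ b))))
  where
  open Reindexing R
  open Classes <-sto M M′ persp
  open Toggle <-sto using (toggle-Avoiding; toggle-Absorbing; toggle-involutive)
  open CommutativeRing R using (reflexive)
  open Evaluation R
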